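{- The synchronization problem $\textsc{Synchro}$ for rendez-vous protocols is undecidable, and it remains undecidable when restricted to wait-only protocols.
   Context: A rendez-vous protocol is a tuple $\mathcal P=(Q,\Sigma,q_{in},q_f,T)$ with $Q$ a finite set of states, $\Sigma$ a finite alphabet, $q_{in},q_f\in Q$, and $T\subseteq Q\times(\{\tau\}\cup\{?m,!m\mid m\in\Sigma\})\times Q$ finite. It is wait-only if $Q$ can be partitioned into active states $Q_A$ and waiting states $Q_W$ with $q_{in}\in Q_A$ such that no transition $(q,?m,q')$ has $q\in Q_A$, and no transition $(q,!m,q')$ or $(q,\tau,q')$ has $q\in Q_W$. A configuration is a non-empty multiset $C$ over $Q$; it is initial if $C(q)=0$ for all $q\neq q_{in}$. $\langle q_1,q_2\rangle$ denotes a multiset. The (non-blocking) semantics: $C\to C'$ iff one of: (internal) there is $(q,\tau,q')\in T$ with $C(q)>0$ and $C'=C-\langle q\rangle+\langle q'\rangle$; (rendez-vous) there are $(q_1,!m,q_1'),(q_2,?m,q_2')\in T$ with $C(q_1)>0$, $C(q_2)>0$, $C(q_1)+C(q_2)\ge2$ and $C'=C-\langle q_1,q_2\rangle+\langle q_1',q_2'\rangle$; (non-blocking request) there is $(q_1,!m,q_1')\in T$ with $C(q_1)>0$, $(C-\langle q_1\rangle)(q_2)=0$ for all $(q_2,?m,q_2')\in T$, and $C'=C-\langle q_1\rangle+\langle q_1'\rangle$. $\textsc{Synchro}$: given $\mathcal P$, decide whether there exist an initial $C_0$ and a configuration $C_f$ with $C_f(q)=0$ for all $q\neq q_f$ and $C_0\to^*C_f$.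 -}

module Defs where

open import Data.Nat using (ℕ; zero; suc; _+_; _*_; _∸_; _≥_; _>_; pred)
open import Data.Nat.Properties using () renaming (_≟_ to _≟ℕ_)
open import Data.Fin using (Fin; toℕ; _≟_)
open import Data.List using (List; []; _∷_)
open import Data.List.Membership.Propositional using (_∈_)
open import Data.Maybe using (Maybe; just; nothing)
open import Data.Bool using (Bool; true; false; if_then_else_)
open import Data.Product using (Σ; ∃; _×_; _,_)
open import Data.Sum using (_⊎_)
open import Relation.Nullary using (¬_; Dec; yes; no)
open import Relation.Nullary.Decidable using (⌊_⌋)
open import Relation.Binary.PropositionalEquality using (_≡_; _≢_)
open import Relation.Binary.Construct.Closure.ReflexiveTransitive using (Star)

data Action (nΣ : ℕ) : Set where
  τ    : Action nΣ
  send : Fin nΣ → Action nΣ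
  recv : Fin nΣ → Action nΣ

record Protocol : Set where
  field
    nQ  : ℕ
    nΣ  : ℕ
    qin : Fin nQ
    qf  : Fin nQ
    T   : List (Fin nQ × Action nΣ × Fin nQ)

-- Multisets over the states (configurations are non-empty ones)
Multiset : ℕ → Set
Multiset n = Fin n → ℕ

size : ∀ {n} → Multiset n → ℕ
size {zero}  C = 0
size {suc n} C = C Fin.zero + size {n} (λ i → C (Fin.suc i))
  where import Data.Fin as Fin

δ : ∀ {n} → Fin n → Fin n → ℕ
δ q p = if ⌊ q ≟ p ⌋ then 1 else 0

move₁ : ∀ {n} → Multiset n → Fin n → Fin n → Multiset n
move₁ C q q' p = (C p ∸ δ q p) + δ q' p

move₂ : ∀ {n} → Multiset n → Fin n → Fin n → Fin n → Fin n → Multiset n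
move₂ C q₁ q₂ q₁' q₂' p = ((C p ∸ δ q₁ p) ∸ δ q₂ p) + δ q₁' p + δ q₂' p

remove : ∀ {n} → Multiset n → Fin n → Multiset n
remove C q p = C p ∸ δ q p

module _ (P : Protocol) where
  open Protocol P

  Config : Set
  Config = Multiset nQ

  data Step (C : Config) : Config → Set where
    internal : ∀ {q q'} → (q , τ , q') ∈ T → C q > 0 →
               Step C (move₁ C q q')
    rendezvous : ∀ {q₁ q₁' q₂ q₂' m} →
               (q₁ , send m , q₁') ∈ T → (q₂ , recv m , q₂') ∈ T →
               C q₁ > 0 → C q₂ > 0 → C q₁ + C q₂ ≥ 2 →
               Step C (move₂ C q₁ q₂ q₁' q₂')
    nonblocking : ∀ {q₁ q₁' m} →
               (q₁ , send m , q₁') ∈ T → C q₁ > 0 →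
               (∀ {q₂ q₂'} → (q₂ , recv m , q₂') ∈ T → remove C q₁ q₂ ≡ 0) →
               Step C (move₁ C q₁ q₁')

  Reach : Config → Config → Set
  Reach = Star Step

  Initial : Config → Set
  Initial C = size C > 0 × (∀ q → q ≢ qin → C q ≡ 0)

  Final : Config → Set
  Final C = size C > 0 × (∀ q → q ≢ qf → C q ≡ 0)

  Synchro : Set
  Synchro = Σ Config λ C₀ → Σ Config λ C_f → Initial C₀ × Final C_f × Reach C₀ C_f

  WaitOnly : Set
  WaitOnly = Σ (Fin nQ → Bool) λ active →
      active qin ≡ true
    × (∀ {q m q'} → (q , recv m , q') ∈ T → active q ≡ false)
    × (∀ {q m q'} → (q , send m , q') ∈ T → active q ≡ true)
    × (∀ {q q'}   → (q , τ , q') ∈ T → active q ≡ true)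

-- Model of computation: Minsky register machines with unboundedly many
-- registers indexed by ℕ.  Input in register 0 (others 0); when control
-- reaches halt (or leaves the program), the output is register 0.

data Instr : Set where
  inc  : (r j : ℕ) → Instr
  decj : (r j k : ℕ) → Instr
  halt : Instr

Program : Set
Program = List Instr

nth : ∀ {A : Set} → List A → ℕ → Maybe A
nth []       _       = nothing
nth (x ∷ xs) zero    = just x
nth (x ∷ xs) (suc n) = nth xs n

update : (ℕ → ℕ) → ℕ → ℕ → (ℕ → ℕ)
update R r v i = if ⌊ i ≟ℕ r ⌋ then v else R i

run : Program → ℕ → (ℕ → ℕ) → ℕ → Maybe ℕ
run M pc R zero = nothing
run M pc R (suc k) with nth M pc
... | nothing         = just (R 0)
... | just halt       = just (R 0)
... | just (inc r j)  = run M j (update R r (suc (R r))) k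
... | just (decj r j l) with R r
...   | zero  = run M l R k
...   | suc v = run M j (update R r v) k

initRegs : ℕ → (ℕ → ℕ)
initRegs n zero    = n
initRegs n (suc _) = 0

Computes : Program → ℕ → ℕ → Set
Computes M n out = ∃ λ fuel → run M 0 (initRegs n) fuel ≡ just out

pair : ℕ → ℕ → ℕ       -- Cantor pairing
pair a b = ((a + b) * suc (a + b)) Data.Nat./ 2 + b
  where import Data.Nat

encList : List ℕ → ℕ
encList []       = 0
encList (x ∷ xs) = suc (pair x (encList xs))

encAction : ∀ {n} → Action n → ℕ
encAction τ        = 0
encAction (send m) = suc (2 * toℕ m)
encAction (recv m) = 2 + 2 * toℕ m

encTrans : ∀ {n s} → Fin n × Action s × Fin n → ℕ
encTrans (q , a , q') = pair (toℕ q) (pair (encAction a) (toℕ q'))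

mapL : ∀ {A B : Set} → (A → B) → List A → List B
mapL f []       = []
mapL f (x ∷ xs) = f x ∷ mapL f xs

code : Protocol → ℕ
code P = encList (nQ ∷ nΣ ∷ toℕ qin ∷ toℕ qf ∷ encList (mapL encTrans T) ∷ [])
  where open Protocol P

DecidesOn : (Protocol → Set) → (Protocol → Set) → Program → Set
DecidesOn Class Prob M = ∀ P → Class P →
  (Prob P → Computes M (code P) 1) × (¬ Prob P → Computes M (code P) 0)

Decidable-on : (Protocol → Set) → (Protocol → Set) → Set
Decidable-on Class Prob = ∃ λ (M : Program) → DecidesOn Class Prob M

AllProtocols : Protocol → Set
AllProtocols _ = Data.Unit.⊤
  where import Data.Unit

{-# OPTIONS --safe #-}
module Submission where

-- A wait-only protocol simulates a register machine.  One process, the leader, is the control;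
-- a process waiting in state one r is a unit of register r.  Increments and decrements are
-- acknowledged, and the leader gets stuck if nobody answers; a zero test is a request which a unit
-- of the tested register can only answer by dying, so it succeeds exactly when it is not received.
-- All processes have to end in qf: a dead process never does, and since a leader leaves by a
-- request that kills any process already in qf, a second leader is impossible.
--
-- Suppose M decides the problem.  Let t be the code of those transitions of the protocol that
-- simulate a machine N, and add a loader of t leader states which puts t into register 0.
-- The code of the whole protocol is a primitive recursive function of t that does not depend
-- on N, so N can be chosen to compute it from t and then to run M on it.  The protocol is
-- then synchronisable exactly if M answers 0 on its own code.

open import Defs
open import Data.Bool using (Bool; true; false; T; if_then_else_)
open import Data.Empty using (⊥)
open import Data.Fin as Fin using (Fin; zero; suc; toℕ)
open import Data.List using (List; []; _∷_; _++_; length; map; concatMap; upTo)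
open import Data.List.Membership.Propositional using (_∈_; find; lose)
open import Data.List.Membership.Propositional.Properties
  using (∈-map⁺; ∈-map⁻; ∈-++⁻; ∈-++⁺ˡ; ∈-++⁺ʳ; ∈-concatMap⁻; ∈-concatMap⁺; ∈-upTo⁺; ∈-upTo⁻)
open import Data.List.Properties using (length-++)
open import Data.List.Relation.Unary.All as All using (All; []; _∷_)
open import Data.List.Relation.Unary.Any using (here; there)
open import Data.Maybe as Maybe using (just; nothing)
open import Data.Maybe.Properties using (just-injective)
open import Data.Nat
  using (ℕ; zero; suc; _+_; _*_; _∸_; _⊓_; _≤_; _<_; _>_; _≥_; _≡ᵇ_; z≤n; s≤s; z<s)
open import Data.Nat.DivMod using (_/_; m*n/n≡m)
open import Data.Nat.Properties
open import Data.Nat.Tactic.RingSolver using (solve-∀)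
open import Data.Product using (∃; _×_; _,_; proj₁; proj₂)
open import Data.Sum using (_⊎_; inj₁; inj₂)
open import Data.Unit using (⊤; tt)
open import Data.Vec using (Vec; []; _∷_; lookup)
open import Relation.Binary.Construct.Closure.ReflexiveTransitive using (ε; _◅_)
open import Relation.Binary.PropositionalEquality
open import Relation.Nullary using (¬_; yes; no; contradiction)
open import Relation.Nullary.Decidable using (⌊_⌋)

-- Most runs of the protocol do not simulate anything: a request may be lost, several leaders may be
-- launched, an acknowledgement may come from a stray process. None of this can be forbidden
-- locally, because a send never blocks. It is excluded only because such a run cannot be completed
-- to a final configuration. Hence the invariant `Good` is proved backwards, and it speaks of the
-- counter machine halting from the present registers, not of how they arose.
--
-- The self-reference needs no recursion theorem, since three choices make the code depend on t
-- alone. States and messages are numbered independently of N. The fixed transitions form the tail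
-- of the list, so their code t is literally the starting value of the fold that codes the
-- transitions in front of them. Cantor pairing dominates its arguments, so t exceeds every address
-- of N and bounds every code in the tail; it therefore also supplies the fresh addresses t to 2t of
-- the loader and the sizes of the state set and of the alphabet.

Regs : Set
Regs = ℕ → ℕ

-- Register updates and runs of register machines

update-same : ∀ R r v → update R r v r ≡ v
update-same R r v with r ≟ r
... | yes _ = refl
... | no ¬p = contradiction refl ¬p

update-other : ∀ R {r} v {x} → x ≢ r → update R r v x ≡ R x
update-other R {r} v {x} x≢r with x ≟ r
... | yes p = contradiction p x≢r
... | no _ = refl

update-cong : ∀ {R S v w} r → R ≗ S → v ≡ w → update R r v ≗ update S r w
update-cong r R≗S v≡w x with x ≟ r
... | yes _ = v≡w
... | no _ = R≗S x

run-inc : ∀ N {pc R r j} f → nth N pc ≡ just (inc r j) →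
          run N pc R (suc f) ≡ run N j (update R r (suc (R r))) f
run-inc N f eq rewrite eq = refl

run-zero : ∀ N {pc R r j k} f → nth N pc ≡ just (decj r j k) → R r ≡ 0 →
           run N pc R (suc f) ≡ run N k R f
run-zero N f eq z rewrite eq | z = refl

run-dec : ∀ N {pc R r j k v} f → nth N pc ≡ just (decj r j k) → R r ≡ suc v →
          run N pc R (suc f) ≡ run N j (update R r v) f
run-dec N f eq s rewrite eq | s = refl

-- Register files obtained in different ways agree only pointwise, so `run` has to be shown
-- insensitive to the difference.
run-cong : ∀ N pc {R S} f → R ≗ S → run N pc R f ≡ run N pc S f
run-cong N pc zero e = refl
run-cong N pc {R} {S} (suc f) e with nth N pc
... | nothing = cong just (e 0)
... | just halt = cong just (e 0)
... | just (inc r j) = run-cong N j f (update-cong r e (cong suc (e r)))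
... | just (decj r j k) with R r | S r | e r
...   | zero  | .zero    | refl = run-cong N k f e
...   | suc v | .(suc v) | refl = run-cong N j f (update-cong r e refl)

run-mono : ∀ N pc R f g {x} → run N pc R f ≡ just x → run N pc R (f + g) ≡ just x
run-mono N pc R (suc f) g eq with nth N pc
... | nothing = eq
... | just halt = eq
... | just (inc r j) = run-mono N j _ f g eq
... | just (decj r j k) with R r
...   | zero  = run-mono N k _ f g eq
...   | suc v = run-mono N j _ f g eq

-- While programs and their compilation

data Cmd : Set where
  inc clr : (r : ℕ) → Cmd
  _⨾_     : Cmd → Cmd → Cmd
  while   : (r : ℕ) → Cmd → Cmd

infixr 5 _⨾_

infix 4 _⊢_⇓_

data _⊢_⇓_ : Cmd → Regs → Regs → Set where
  inc     : ∀ {r R} → inc r ⊢ R ⇓ update R r (suc (R r))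
  clr-z   : ∀ {r R} → R r ≡ 0 → clr r ⊢ R ⇓ R
  clr-s   : ∀ {r R R′ v} → R r ≡ suc v → clr r ⊢ update R r v ⇓ R′ → clr r ⊢ R ⇓ R′
  _⨾_     : ∀ {c d R S T} → c ⊢ R ⇓ S → d ⊢ S ⇓ T → c ⨾ d ⊢ R ⇓ T
  while-z : ∀ {r c R} → R r ≡ 0 → while r c ⊢ R ⇓ R
  while-s : ∀ {r c R S T v} → R r ≡ suc v → c ⊢ update R r v ⇓ S →
            while r c ⊢ S ⇓ T → while r c ⊢ R ⇓ T

len : Cmd → ℕ
len (inc r)     = 1
len (clr r)     = 1
len (c ⨾ d)     = len c + len d
len (while r c) = suc (len c)

-- Code for c placed at address o and leaving to address k.
compile : Cmd → (o k : ℕ) → Program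
compile (inc r)     o k = inc r k ∷ []
compile (clr r)     o k = decj r o k ∷ []
compile (c ⨾ d)     o k = compile c o (o + len c) ++ compile d (o + len c) k
compile (while r c) o k = decj r (suc o) k ∷ compile c (suc o) o

length-compile : ∀ c o k → length (compile c o k) ≡ len c
length-compile (inc r) o k = refl
length-compile (clr r) o k = refl
length-compile (c ⨾ d) o k =
  trans (length-++ (compile c o (o + len c)))
        (cong₂ _+_ (length-compile c o _) (length-compile d _ k))
length-compile (while r c) o k = cong suc (length-compile c _ _)

nth-++ˡ : ∀ {A : Set} (xs ys : List A) i {x} → nth xs i ≡ just x → nth (xs ++ ys) i ≡ just x
nth-++ˡ (x ∷ xs) ys zero    e = e
nth-++ˡ (x ∷ xs) ys (suc i) e = nth-++ˡ xs ys i e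

nth-++ʳ : ∀ {A : Set} (xs ys : List A) i → nth (xs ++ ys) (length xs + i) ≡ nth ys i
nth-++ʳ []       ys i = refl
nth-++ʳ (x ∷ xs) ys i = nth-++ʳ xs ys i

record CodeAt (N : Program) (o : ℕ) (c : Program) : Set where
  constructor codeAt
  field at : ∀ i {x} → nth c i ≡ just x → nth N (o + i) ≡ just x
open CodeAt

codeAt-++ˡ : ∀ {N o} c d → CodeAt N o (c ++ d) → CodeAt N o c
codeAt-++ˡ c d ca .at i e = ca .at i (nth-++ˡ c d i e)

codeAt-++ʳ : ∀ {N o} c d → CodeAt N o (c ++ d) → CodeAt N (o + length c) d
codeAt-++ʳ {N} {o} c d ca .at i e rewrite +-assoc o (length c) i =
  ca .at (length c + i) (trans (nth-++ʳ c d i) e)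

codeAt-head : ∀ {N o x c} → CodeAt N o (x ∷ c) → nth N o ≡ just x
codeAt-head {N} {o} ca = trans (cong (nth N) (sym (+-identityʳ o))) (ca .at 0 refl)

codeAt-tail : ∀ {N o x c} → CodeAt N o (x ∷ c) → CodeAt N (suc o) c
codeAt-tail {N} {o} ca .at i e = trans (cong (nth N) (sym (+-suc o i))) (ca .at (suc i) e)

-- An equation for every amount of remaining fuel transports results in both directions, and the
-- final contradiction uses both.
record Leads (N : Program) (pc : ℕ) (R : Regs) (pc′ : ℕ) (R′ : Regs) : Set where
  constructor leads
  field
    time   : ℕ
    follow : ∀ f → run N pc R (time + f) ≡ run N pc′ R′ f

leads-trans : ∀ {N p R q S r T} → Leads N p R q S → Leads N q S r T → Leads N p R r T
leads-trans {N} {p} {R} (leads m em) (leads n en) =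
  leads (m + n) λ f → trans (cong (run N p R) (+-assoc m n f)) (trans (em (n + f)) (en f))

-- By induction on the evaluation, not on the command: a further round of a loop is the same command
-- at the same address.
compile-correct : ∀ {N} c {o k R R′} → c ⊢ R ⇓ R′ → CodeAt N o (compile c o k) → Leads N o R k R′
compile-correct {N} (inc r) inc ca = leads 1 λ f → run-inc N f (codeAt-head ca)
compile-correct {N} (clr r) (clr-z z) ca = leads 1 λ f → run-zero N f (codeAt-head ca) z
compile-correct {N} (clr r) (clr-s s e) ca =
  leads-trans (leads 1 λ f → run-dec N f (codeAt-head ca) s) (compile-correct (clr r) e ca)
compile-correct {N} (c ⨾ d) {o} {k} (e₁ ⨾ e₂) ca = leads-trans
  (compile-correct c e₁ (codeAt-++ˡ (compile c o (o + len c)) _ ca))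
  (compile-correct d e₂ (subst (λ l → CodeAt N (o + l) (compile d (o + len c) k))
    (length-compile c o _) (codeAt-++ʳ (compile c o (o + len c)) _ ca)))
compile-correct {N} (while r c) (while-z z) ca = leads 1 λ f → run-zero N f (codeAt-head ca) z
compile-correct {N} (while r c) (while-s s e₁ e₂) ca =
  leads-trans (leads 1 λ f → run-dec N f (codeAt-head ca) s)
    (leads-trans (compile-correct c e₁ (codeAt-tail ca)) (compile-correct (while r c) e₂ ca))

infix 4 _⊢_⇓≗_

_⊢_⇓≗_ : Cmd → Regs → Regs → Set
c ⊢ R ⇓≗ S = ∃ λ R′ → (c ⊢ R ⇓ R′) × (R′ ≗ S)

-- The target `S` is characterised by its values, so that each caller can name the resulting
-- register file in its own form. The same holds for `move` and `move-both`.
clear-reg : ∀ r {R S} → S r ≡ 0 → (∀ x → x ≢ r → R x ≡ S x) → clr r ⊢ R ⇓≗ S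
clear-reg r {R} {S} Sr = go (R r) R refl
  where
  go : ∀ v R → R r ≡ v → (∀ x → x ≢ r → R x ≡ S x) → clr r ⊢ R ⇓≗ S
  go zero R e same = R , clr-z e , eq
    where
    eq : R ≗ S
    eq x with x ≟ r
    ... | yes refl = trans e (sym Sr)
    ... | no x≢r = same x x≢r
  go (suc v) R e same
    with go v (update R r v) (update-same R r v)
            (λ x x≢r → trans (update-other R v x≢r) (same x x≢r))
  ... | R′ , ex , eq = R′ , clr-s e ex , eq

move : ∀ a b {R S} → a ≢ b → S a ≡ 0 → S b ≡ R a + R b →
       (∀ x → x ≢ a → x ≢ b → R x ≡ S x) → while a (inc b) ⊢ R ⇓≗ S
move a b {R} {S} a≢b Sa = go (R a) R refl
  where
  go : ∀ v R → R a ≡ v → S b ≡ v + R b → (∀ x → x ≢ a → x ≢ b → R x ≡ S x) →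
       while a (inc b) ⊢ R ⇓≗ S
  go zero R e Sb same = R , while-z e , eq
    where
    eq : R ≗ S
    eq x with x ≟ a | x ≟ b
    ... | yes refl | _ = trans e (sym Sa)
    ... | no _ | yes refl = sym Sb
    ... | no x≢a | no x≢b = same x x≢a x≢b
  go (suc v) R e Sb same
    with go v R₂
            (trans (update-other R₁ _ a≢b) (update-same R a v))
            (trans Sb (trans (sym (+-suc v (R b))) (cong (v +_)
              (sym (trans (update-same R₁ b _) (cong suc (update-other R v (≢-sym a≢b))))))))
            (λ x x≢a x≢b → trans (update-other R₁ _ x≢b) (trans (update-other R v x≢a) (same x x≢a x≢b)))
    where
    R₁ R₂ : Regs
    R₁ = update R a v
    R₂ = update R₁ b (suc (R₁ b))
  ... | R′ , ex , eq = R′ , while-s e inc ex , eq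

move-both : ∀ a b c {R S} → a ≢ b → a ≢ c → b ≢ c → S a ≡ 0 → S b ≡ R a + R b → S c ≡ R a + R c →
        (∀ x → x ≢ a → x ≢ b → x ≢ c → R x ≡ S x) → while a (inc b ⨾ inc c) ⊢ R ⇓≗ S
move-both a b c {R} {S} a≢b a≢c b≢c Sa = go (R a) R refl
  where
  go : ∀ v R → R a ≡ v → S b ≡ v + R b → S c ≡ v + R c →
       (∀ x → x ≢ a → x ≢ b → x ≢ c → R x ≡ S x) → while a (inc b ⨾ inc c) ⊢ R ⇓≗ S
  go zero R e Sb Sc same = R , while-z e , eq
    where
    eq : R ≗ S
    eq x with x ≟ a | x ≟ b | x ≟ c
    ... | yes refl | _ | _ = trans e (sym Sa)
    ... | no _ | yes refl | _ = sym Sb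
    ... | no _ | no _ | yes refl = sym Sc
    ... | no x≢a | no x≢b | no x≢c = same x x≢a x≢b x≢c
  go (suc v) R e Sb Sc same
    with go v R₃
            (trans (update-other R₂ _ a≢c) (trans (update-other R₁ _ a≢b) (update-same R a v)))
            (trans Sb (trans (sym (+-suc v (R b))) (cong (v +_)
              (sym (trans (update-other R₂ _ b≢c)
                (trans (update-same R₁ b _) (cong suc (update-other R v (≢-sym a≢b)))))))))
            (trans Sc (trans (sym (+-suc v (R c))) (cong (v +_)
              (sym (trans (update-same R₂ c _) (cong suc
                (trans (update-other R₁ _ (≢-sym b≢c)) (update-other R v (≢-sym a≢c)))))))))
            (λ x x≢a x≢b x≢c → trans (update-other R₂ _ x≢c) (trans (update-other R₁ _ x≢b)
              (trans (update-other R v x≢a) (same x x≢a x≢b x≢c))))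
    where
    R₁ R₂ R₃ : Regs
    R₁ = update R a v
    R₂ = update R₁ b (suc (R₁ b))
    R₃ = update R₂ c (suc (R₂ c))
  ... | R′ , ex , eq = R′ , while-s e (inc ⨾ inc) ex , eq

-- Primitive recursive expressions

data Exp : ℕ → Set where
  var  : ∀ {Γ} → Fin Γ → Exp Γ
  ze   : ∀ {Γ} → Exp Γ
  su   : ∀ {Γ} → Exp Γ → Exp Γ
  loop : ∀ {Γ} → Exp Γ → Exp Γ → Exp (suc (suc Γ)) → Exp Γ

-- The indices descend from n - 1 to 0 because a `while` loop decrements its register before the
-- body runs; `load` adds its edges in this order as well.
downto0 : (ℕ → ℕ → ℕ) → ℕ → ℕ → ℕ
downto0 f zero    a = a
downto0 f (suc m) a = downto0 f m (f m a)

⟦_⟧ : ∀ {Γ} → Exp Γ → Vec ℕ Γ → ℕ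
⟦ var i ⟧      ρ = lookup ρ i
⟦ ze ⟧         ρ = 0
⟦ su e ⟧       ρ = suc (⟦ e ⟧ ρ)
⟦ loop n b s ⟧ ρ = downto0 (λ m a → ⟦ s ⟧ (a ∷ m ∷ ρ)) (⟦ n ⟧ ρ) (⟦ b ⟧ ρ)

-- The variables live in the registers σ, all below d; the value goes to register d,
-- and all higher registers are zero before and after.
cmd : ∀ {Γ} → ℕ → Vec ℕ Γ → Exp Γ → Cmd
cmd d σ (var i)      = while (lookup σ i) (inc d ⨾ inc (suc d)) ⨾ while (suc d) (inc (lookup σ i))
cmd d σ ze           = clr d
cmd d σ (su e)       = cmd d σ e ⨾ inc d
cmd d σ (loop n b s) = cmd d σ n ⨾ cmd (suc d) σ b ⨾
  while d (cmd (suc (suc d)) (suc d ∷ d ∷ σ) s ⨾ clr (suc d) ⨾ while (suc (suc d)) (inc (suc d))) ⨾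
  while (suc d) (inc d)

data Env (R : Regs) (d : ℕ) : ∀ {Γ} → Vec ℕ Γ → Vec ℕ Γ → Set where
  []   : Env R d [] []
  bind : ∀ {Γ r x} {σ ρ : Vec ℕ Γ} → r < d → R r ≡ x → Env R d σ ρ → Env R d (r ∷ σ) (x ∷ ρ)

reg-< : ∀ {R d Γ} {σ ρ : Vec ℕ Γ} → Env R d σ ρ → ∀ i → lookup σ i < d
reg-< (bind l _ _)   zero    = l
reg-< (bind _ _ env) (suc i) = reg-< env i

env-lookup : ∀ {R d Γ} {σ ρ : Vec ℕ Γ} → Env R d σ ρ → ∀ i → R (lookup σ i) ≡ lookup ρ i
env-lookup (bind _ e _)   zero    = e
env-lookup (bind _ _ env) (suc i) = env-lookup env i

env-cong : ∀ {R S d d′ Γ} {σ ρ : Vec ℕ Γ} → d ≤ d′ → (∀ x → x < d → R x ≡ S x) → Env R d σ ρ → Env S d′ σ ρ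
env-cong le h []            = []
env-cong le h (bind l e env) = bind (≤-trans l le) (trans (sym (h _ l)) e) (env-cong le h env)

zero-above : ∀ {R S : Regs} {d} v → S ≗ update R d v → (∀ x → d ≤ x → R x ≡ 0) → ∀ x → suc d ≤ x → S x ≡ 0
zero-above {R} v eq z x d<x = trans (eq x) (trans (update-other R v (>⇒≢ d<x)) (z x (<⇒≤ d<x)))

unchanged-below : ∀ {R S : Regs} {d} v → S ≗ update R d v → ∀ x → x < d → R x ≡ S x
unchanged-below {R} v eq x x<d = sym (trans (eq x) (update-other R v (<⇒≢ x<d)))

cmd-correct : ∀ {Γ} (e : Exp Γ) {d R} {σ ρ : Vec ℕ Γ} → Env R d σ ρ → (∀ x → d ≤ x → R x ≡ 0) →
              cmd d σ e ⊢ R ⇓≗ update R d (⟦ e ⟧ ρ)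
cmd-correct (var i) {d} {R} {σ} {ρ} env z = S₂ , ex₁ ⨾ ex₂ , eq₂
  where
  r = lookup σ i
  r<d = reg-< env i
  -- State between the two loops: reading the variable has emptied its register, and the second
  -- copy, in `suc d`, serves to restore it.
  mid : Regs
  mid = update (update (update R r 0) d (R r)) (suc d) (R r)
  mid-sd : mid (suc d) ≡ R r
  mid-sd = update-same (update (update R r 0) d (R r)) (suc d) (R r)
  mid-d : mid d ≡ R r
  mid-d = trans (update-other (update (update R r 0) d (R r)) (R r) (<⇒≢ (n<1+n d))) (update-same (update R r 0) d (R r))
  mid-r : mid r ≡ 0
  mid-r = trans (update-other (update (update R r 0) d (R r)) (R r) (<⇒≢ (m<n⇒m<1+n r<d)))
    (trans (update-other (update R r 0) (R r) (<⇒≢ r<d)) (update-same R r 0))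
  mid-x : ∀ x → x ≢ r → x ≢ d → x ≢ suc d → mid x ≡ R x
  mid-x x ≢r ≢d ≢sd = trans (update-other (update (update R r 0) d (R r)) (R r) ≢sd)
    (trans (update-other (update R r 0) (R r) ≢d) (update-other R 0 ≢r))
  res = move-both r d (suc d) {R} {mid} (<⇒≢ r<d) (<⇒≢ (m<n⇒m<1+n r<d)) (<⇒≢ ≤-refl) mid-r
    (trans mid-d (trans (sym (+-identityʳ (R r))) (cong (R r +_) (sym (z d ≤-refl)))))
    (trans mid-sd (trans (sym (+-identityʳ (R r))) (cong (R r +_) (sym (z (suc d) (n≤1+n d))))))
    (λ x a b c → sym (mid-x x a b c))
  S₁ = proj₁ res
  ex₁ = proj₁ (proj₂ res)
  eq₁ = proj₂ (proj₂ res)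
  final : Regs
  final = update R d (lookup ρ i)
  res₂ = move (suc d) r {S₁} {final} (>⇒≢ (m<n⇒m<1+n r<d))
    (trans (update-other R _ (>⇒≢ ≤-refl)) (z (suc d) (n≤1+n d)))
    (trans (update-other R _ (<⇒≢ r<d)) (sym (trans (cong₂ _+_ (trans (eq₁ (suc d)) mid-sd) (trans (eq₁ r) mid-r)) (+-identityʳ (R r)))))
    same
    where
    same : ∀ x → x ≢ suc d → x ≢ r → S₁ x ≡ final x
    same x ≢sd ≢r with x ≟ d
    ... | yes refl = trans (eq₁ d) (trans mid-d (env-lookup env i))
    ... | no ≢d = trans (eq₁ x) (mid-x x ≢r ≢d ≢sd)
  S₂ = proj₁ res₂
  ex₂ = proj₁ (proj₂ res₂)
  eq₂ = proj₂ (proj₂ res₂)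
cmd-correct ze {d} {R} env z =
  clear-reg d (update-same R d 0) (λ x x≢d → sym (update-other R 0 x≢d))
cmd-correct (su e) {d} {R} {σ} {ρ} env z with cmd-correct e env z
... | S , ex , eq = _ , ex ⨾ inc , eq′
  where
  eq′ : update S d (suc (S d)) ≗ update R d (suc (⟦ e ⟧ ρ))
  eq′ x with x ≟ d
  ... | yes refl = cong suc (trans (eq d) (update-same R d _))
  ... | no x≢d = trans (eq x) (update-other R _ x≢d)
cmd-correct (loop n b s) {d} {R} {σ} {ρ} env z
  with cmd-correct n env z
... | S₁ , ex₁ , eq₁
  with cmd-correct b (env-cong (n≤1+n d) (unchanged-below _ eq₁) env) (zero-above _ eq₁ z)
... | S₂ , ex₂ , eq₂
  with iterate (⟦ n ⟧ ρ) S₂ _ (trans (eq₂ d) (trans (update-other S₁ _ (<⇒≢ ≤-refl)) (trans (eq₁ d) (update-same R d _))))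
         (trans (eq₂ (suc d)) (update-same S₁ (suc d) _)) rest
  where
  rest : ∀ x → x ≢ d → x ≢ suc d → S₂ x ≡ R x
  rest x ≢d ≢sd = trans (eq₂ x) (trans (update-other S₁ _ ≢sd) (trans (eq₁ x) (update-other R _ ≢d)))
  body = cmd (suc (suc d)) (suc d ∷ d ∷ σ) s ⨾ clr (suc d) ⨾ while (suc (suc d)) (inc (suc d))
  step : ℕ → ℕ → ℕ
  step m a = ⟦ s ⟧ (a ∷ m ∷ ρ)
  -- Loop invariant: `d` counts the rounds left, `suc d` holds the accumulator, and all else is as
  -- at the start. In particular the registers from `suc (suc d)` on are zero again, as the next
  -- evaluation of `s` requires.
  iterate : ∀ m S a → S d ≡ m → S (suc d) ≡ a → (∀ x → x ≢ d → x ≢ suc d → S x ≡ R x) →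
            while d body ⊢ S ⇓≗ update R (suc d) (downto0 step m a)
  iterate zero S a Sd Ssd same = S , while-z Sd , eq
    where
    eq : S ≗ update R (suc d) a
    eq x with x ≟ d | x ≟ suc d
    ... | _ | yes refl = Ssd
    ... | yes refl | no _ = trans Sd (sym (z d ≤-refl))
    ... | no ≢d | no ≢sd = same x ≢d ≢sd
  iterate (suc m) S a Sd Ssd same
    with cmd-correct s {suc (suc d)} {update S d m}
           (bind (n<1+n _) (trans (update-other S m (>⇒≢ ≤-refl)) Ssd) (bind (m<n⇒m<1+n (n<1+n d)) (update-same S d m)
             (env-cong (≤-trans (n≤1+n d) (n≤1+n _)) (λ x x<d → sym (trans (update-other S m (<⇒≢ x<d)) (same x (<⇒≢ x<d) (<⇒≢ (m<n⇒m<1+n x<d))))) env)))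
           (λ x le → trans (update-other S m (>⇒≢ (<⇒≤ le))) (trans (same x (>⇒≢ (<⇒≤ le)) (>⇒≢ le)) (z x (≤-trans (n≤1+n d) (<⇒≤ le)))))
  ... | U₁ , e₁ , q₁
    with clear-reg (suc d) {U₁} {update U₁ (suc d) 0} (update-same U₁ (suc d) 0) (λ x ≢sd → sym (update-other U₁ 0 ≢sd))
  ... | U₂ , e₂ , q₂
    with move (suc (suc d)) (suc d) {U₂} {update (update S d m) (suc d) (step m a)} (>⇒≢ ≤-refl)
           (trans (update-other (update S d m) _ (>⇒≢ ≤-refl)) (trans (update-other S m (>⇒≢ (n≤1+n _)))
              (trans (same (suc (suc d)) (>⇒≢ (n≤1+n _)) (>⇒≢ ≤-refl)) (z _ (≤-trans (n≤1+n d) (n≤1+n _))))))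
           (trans (update-same (update S d m) (suc d) _) (sym (trans
             (cong₂ _+_ (trans (q₂ (suc (suc d))) (trans (update-other U₁ 0 (>⇒≢ ≤-refl)) (trans (q₁ (suc (suc d))) (update-same (update S d m) (suc (suc d)) _))))
                        (trans (q₂ (suc d)) (update-same U₁ (suc d) 0)))
             (+-identityʳ _))))
           (λ x ≢ssd ≢sd → trans (q₂ x) (trans (update-other U₁ 0 ≢sd) (trans (q₁ x)
             (trans (update-other (update S d m) _ ≢ssd) (sym (update-other (update S d m) _ ≢sd))))))
  ... | U₃ , e₃ , q₃
    with iterate m U₃ (step m a)
           (trans (q₃ d) (trans (update-other (update S d m) _ (<⇒≢ ≤-refl)) (update-same S d m)))
           (trans (q₃ (suc d)) (update-same (update S d m) (suc d) _))
           (λ x ≢d ≢sd → trans (q₃ x) (trans (update-other (update S d m) _ ≢sd) (trans (update-other S m ≢d) (same x ≢d ≢sd))))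
  ... | U₄ , e₄ , q₄ = U₄ , while-s Sd (e₁ ⨾ e₂ ⨾ e₃) e₄ , q₄
... | S₃ , ex₃ , eq₃
  with move (suc d) d {S₃} {update R d (⟦ loop n b s ⟧ ρ)} (>⇒≢ ≤-refl)
         (trans (update-other R _ (>⇒≢ ≤-refl)) (z (suc d) (n≤1+n d)))
         (trans (update-same R d _) (sym (trans
            (cong₂ _+_ (trans (eq₃ (suc d)) (update-same R (suc d) _))
                       (trans (eq₃ d) (trans (update-other R _ (<⇒≢ ≤-refl)) (z d ≤-refl))))
            (+-identityʳ _))))
         (λ x ≢sd ≢d → trans (eq₃ x) (trans (update-other R _ ≢sd) (sym (update-other R _ ≢d))))
... | S₄ , ex₄ , eq₄ = S₄ , ex₁ ⨾ ex₂ ⨾ ex₃ ⨾ ex₄ , eq₄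

-- Running a program after a precomputation of its input

shift : ℕ → Instr → Instr
shift o (inc r j)    = inc r (o + j)
shift o (decj r j k) = decj r (o + j) (o + k)
shift o halt         = halt

nth-map : ∀ {A B : Set} (g : A → B) xs i → nth (map g xs) i ≡ Maybe.map g (nth xs i)
nth-map g []       i       = refl
nth-map g (x ∷ xs) zero    = refl
nth-map g (x ∷ xs) (suc i) = nth-map g xs i

run-shift : ∀ pre M pc R f →
            run (pre ++ map (shift (length pre)) M) (length pre + pc) R f ≡ run M pc R f
run-shift pre M pc R zero = refl
run-shift pre M pc R (suc f)
  rewrite nth-++ʳ pre (map (shift (length pre)) M) pc | nth-map (shift (length pre)) M pc
  with nth M pc
... | nothing = refl
... | just halt = refl
... | just (inc r j) = run-shift pre M j _ f
... | just (decj r j k) with R r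
...   | zero  = run-shift pre M k R f
...   | suc v = run-shift pre M j _ f

precompute : Exp 1 → Cmd
precompute e = cmd 1 (0 ∷ []) e ⨾ clr 0 ⨾ while 1 (inc 0)

precompute-correct : ∀ e n → precompute e ⊢ initRegs n ⇓≗ initRegs (⟦ e ⟧ (n ∷ []))
precompute-correct e n
  with cmd-correct e {1} {initRegs n} (bind (s≤s z≤n) refl []) (λ { (suc x) _ → refl })
... | S₁ , ex₁ , eq₁
  with clear-reg 0 {S₁} {update S₁ 0 0} (update-same S₁ 0 0) (λ x x≢0 → sym (update-other S₁ 0 x≢0))
... | S₂ , ex₂ , eq₂
  with move 1 0 {S₂} {initRegs (⟦ e ⟧ (n ∷ []))} (λ ()) refl
         (sym (trans (cong₂ _+_ (trans (eq₂ 1) (eq₁ 1)) (eq₂ 0)) (+-identityʳ _)))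
         (λ { zero _ x≢0 → contradiction refl x≢0
            ; (suc zero) x≢1 _ → contradiction refl x≢1
            ; (suc (suc x)) _ _ → trans (eq₂ _) (eq₁ _) })
... | S₃ , ex₃ , eq₃ = S₃ , ex₁ ⨾ ex₂ ⨾ ex₃ , eq₃

_after_ : Program → Exp 1 → Program
M after e = pre ++ map (shift (length pre)) M
  where
  pre = compile (precompute e) 0 (len (precompute e))

leads-after : ∀ M e n → ∃ λ k → ∀ f →
              run (M after e) 0 (initRegs n) (k + f) ≡ run M 0 (initRegs (⟦ e ⟧ (n ∷ []))) f
leads-after M e n with precompute-correct e n
... | R′ , ex , eq
  with compile-correct {M after e} (precompute e) {0} {len (precompute e)} ex
         (codeAt λ i → nth-++ˡ (compile (precompute e) 0 _) _ i)
... | leads k follow = k , λ f → trans (follow f) (trans (run-cong (M after e) _ f eq)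
  (trans (cong (λ p → run (M after e) p (initRegs (⟦ e ⟧ (n ∷ []))) f)
           (trans (sym (length-compile (precompute e) 0 _)) (sym (+-identityʳ _))))
         (run-shift (compile (precompute e) 0 _) M 0 _ f)))

-- Sums over finite multisets

size-cong : ∀ {n} {X Y : Multiset n} → X ≗ Y → size X ≡ size Y
size-cong {zero}  e = refl
size-cong {suc n} e = cong₂ _+_ (e zero) (size-cong (λ i → e (suc i)))

size-+ : ∀ {n} (X Y : Multiset n) → size (λ q → X q + Y q) ≡ size X + size Y
size-+ {zero}  X Y = refl
size-+ {suc n} X Y
  rewrite size-+ (λ i → X (suc i)) (λ i → Y (suc i)) =
  interchange (X zero) (Y zero) (size (λ i → X (suc i))) (size (λ i → Y (suc i)))
  where
  interchange : ∀ a b c d → (a + b) + (c + d) ≡ (a + c) + (b + d)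
  interchange = solve-∀

size-zero : ∀ {n} {X : Multiset n} → (∀ q → X q ≡ 0) → size X ≡ 0
size-zero {zero}  z = refl
size-zero {suc n} z = cong₂ _+_ (z zero) (size-zero (λ i → z (suc i)))

≤-size : ∀ {n} (X : Multiset n) q → X q ≤ size X
≤-size X zero    = m≤m+n _ _
≤-size X (suc q) = ≤-trans (≤-size (λ i → X (suc i)) q) (m≤n+m _ _)

size-mono : ∀ {n} {X Y : Multiset n} → (∀ q → X q ≤ Y q) → size X ≤ size Y
size-mono {zero}  le = z≤n
size-mono {suc n} le = +-mono-≤ (le zero) (size-mono (λ i → le (suc i)))

δ-≢ : ∀ {n} {q p : Fin n} → q ≢ p → δ q p ≡ 0
δ-≢ {q = q} {p} q≢p with q Fin.≟ p
... | yes e = contradiction e q≢p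
... | no _ = refl

δ-suc : ∀ {n} (q p : Fin n) → δ (suc q) (suc p) ≡ δ q p
δ-suc q p with q Fin.≟ p
... | yes _ = refl
... | no _ = refl

size-δ : ∀ {n} (g : Multiset n) q → size (λ p → g p * δ q p) ≡ g q
size-δ g zero    = trans (cong₂ _+_ (*-identityʳ (g zero)) (size-zero λ i → *-zeroʳ (g (suc i)))) (+-identityʳ _)
size-δ g (suc q) = trans
  (cong₂ _+_ (*-zeroʳ (g zero)) (size-cong λ i → cong (g (suc i) *_) (δ-suc q i)))
  (size-δ (λ i → g (suc i)) q)

-- Putting the removed process back on the left turns truncated subtraction into an equation that
-- linear functionals preserve.
move₁-balance : ∀ {n} (C : Multiset n) q q′ → C q > 0 →
                ∀ p → move₁ C q q′ p + δ q p ≡ C p + δ q′ p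
move₁-balance C q q′ pos p with q Fin.≟ p
... | no _ = +-identityʳ _
... | yes refl with C q | pos
...   | suc c | _ = lemma c (δ q′ q)
  where
  lemma : ∀ c d → (c + d) + 1 ≡ suc c + d
  lemma = solve-∀

-- With two different states, each subtraction removes a process that is present; in a single state
-- two processes would have to be there.
move₂-balance : ∀ {n} (C : Multiset n) q₁ q₂ q₁′ q₂′ → q₁ ≢ q₂ → C q₁ > 0 → C q₂ > 0 → ∀ p →
                move₂ C q₁ q₂ q₁′ q₂′ p + (δ q₁ p + δ q₂ p) ≡ C p + (δ q₁′ p + δ q₂′ p)
move₂-balance C q₁ q₂ q₁′ q₂′ q₁≢q₂ pos₁ pos₂ p with q₁ Fin.≟ p | q₂ Fin.≟ p
... | yes refl | yes refl = contradiction refl q₁≢q₂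
... | no _ | no _ = trans (+-identityʳ _) (+-assoc (C p) _ _)
... | yes refl | no _ with C q₁ | pos₁
...   | suc c | _ = lemma c (δ q₁′ q₁) (δ q₂′ q₁)
  where
  lemma : ∀ c d e → ((c + d) + e) + 1 ≡ suc c + (d + e)
  lemma = solve-∀
move₂-balance C q₁ q₂ q₁′ q₂′ q₁≢q₂ pos₁ pos₂ p | no _ | yes refl with C q₂ | pos₂
...   | suc c | _ = lemma c (δ q₁′ q₂) (δ q₂′ q₂)
  where
  lemma : ∀ c d e → ((c + d) + e) + 1 ≡ suc c + (d + e)
  lemma = solve-∀

-- The states and messages of the simulating protocol

-- The process at pc i is the leader about to execute the instruction at i, and at w i it
-- waits for an acknowledgement before going there.  A process at one r is a unit of
-- register r; up r and down are on their way to and from that role, spent has left it.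
data St : Set where
  qin qf dead pool spent down : St
  up one pc w : ℕ → St

data Msg : Set where
  ack fin : Msg
  inc dec zero : ℕ → Msg

data Act : Set where
  τ : Act
  send recv : Msg → Act

Trans : Set
Trans = St × Act × St

-- A bijection with the natural numbers: six single states, then four families interleaved modulo 4.
-- Whatever the bound, each element of a `Fin` is thus the number of exactly one state.
enc : St → ℕ
enc qin     = 0
enc qf      = 1
enc dead    = 2
enc pool    = 3
enc spent   = 4
enc down    = 5
enc (up r)  = 6 + r * 4
enc (one r) = 7 + r * 4
enc (pc i)  = 8 + i * 4
enc (w i)   = 9 + i * 4

next : St → St
next (up r)  = up (suc r)
next (one r) = one (suc r)
next (pc i)  = pc (suc i)
next (w i)   = w (suc i)
next s       = s

indexed : ℕ → St
indexed 0 = up 0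
indexed 1 = one 0
indexed 2 = pc 0
indexed 3 = w 0
indexed (suc (suc (suc (suc n)))) = next (indexed n)

dec′ : ℕ → St
dec′ 0 = qin
dec′ 1 = qf
dec′ 2 = dead
dec′ 3 = pool
dec′ 4 = spent
dec′ 5 = down
dec′ (suc (suc (suc (suc (suc (suc n)))))) = indexed n

indexed-up : ∀ r → indexed (r * 4) ≡ up r
indexed-up zero    = refl
indexed-up (suc r) = cong next (indexed-up r)

indexed-one : ∀ r → indexed (1 + r * 4) ≡ one r
indexed-one zero    = refl
indexed-one (suc r) = cong next (indexed-one r)

indexed-pc : ∀ r → indexed (2 + r * 4) ≡ pc r
indexed-pc zero    = refl
indexed-pc (suc r) = cong next (indexed-pc r)

indexed-w : ∀ r → indexed (3 + r * 4) ≡ w r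
indexed-w zero    = refl
indexed-w (suc r) = cong next (indexed-w r)

dec′-enc : ∀ s → dec′ (enc s) ≡ s
dec′-enc qin     = refl
dec′-enc qf      = refl
dec′-enc dead    = refl
dec′-enc pool    = refl
dec′-enc spent   = refl
dec′-enc down    = refl
dec′-enc (up r)  = indexed-up r
dec′-enc (one r) = indexed-one r
dec′-enc (pc i)  = indexed-pc i
dec′-enc (w i)   = indexed-w i

enc-indexed : ∀ n → enc (indexed n) ≡ 6 + n
enc-indexed 0 = refl
enc-indexed 1 = refl
enc-indexed 2 = refl
enc-indexed 3 = refl
enc-indexed (suc (suc (suc (suc n)))) =
  trans (enc-next (indexed n) (subst (6 ≤_) (sym (enc-indexed n)) (m≤m+n 6 n))) (cong (4 +_) (enc-indexed n))
  where
  enc-next : ∀ s → 6 ≤ enc s → enc (next s) ≡ 4 + enc s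
  enc-next qin ()
  enc-next qf (s≤s ())
  enc-next dead (s≤s (s≤s ()))
  enc-next pool (s≤s (s≤s (s≤s ())))
  enc-next spent (s≤s (s≤s (s≤s (s≤s ()))))
  enc-next down (s≤s (s≤s (s≤s (s≤s (s≤s ())))))
  enc-next (up r) _ = refl
  enc-next (one r) _ = refl
  enc-next (pc i) _ = refl
  enc-next (w i) _ = refl

enc-dec′ : ∀ n → enc (dec′ n) ≡ n
enc-dec′ 0 = refl
enc-dec′ 1 = refl
enc-dec′ 2 = refl
enc-dec′ 3 = refl
enc-dec′ 4 = refl
enc-dec′ 5 = refl
enc-dec′ (suc (suc (suc (suc (suc (suc n)))))) = enc-indexed n

encM : Msg → ℕ
encM ack      = 0
encM fin      = 1
encM (inc r)  = 2 + r * 3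
encM (dec r)  = 3 + r * 3
encM (zero r) = 4 + r * 3

nextM : Msg → Msg
nextM (inc r)  = inc (suc r)
nextM (dec r)  = dec (suc r)
nextM (zero r) = zero (suc r)
nextM m        = m

decM : ℕ → Msg
decM 0 = ack
decM 1 = fin
decM 2 = inc 0
decM 3 = dec 0
decM 4 = zero 0
decM (suc (suc (suc n@(suc (suc _))))) = nextM (decM n)

decM-encM : ∀ m → decM (encM m) ≡ m
decM-encM ack            = refl
decM-encM fin            = refl
decM-encM (inc zero)     = refl
decM-encM (inc (suc r))  = cong nextM (decM-encM (inc r))
decM-encM (dec zero)     = refl
decM-encM (dec (suc r))  = cong nextM (decM-encM (dec r))
decM-encM (zero zero)    = refl
decM-encM (zero (suc r)) = cong nextM (decM-encM (zero r))

encA : Act → ℕ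
encA τ        = 0
encA (send m) = suc (2 * encM m)
encA (recv m) = 2 + 2 * encM m

-- Indicator functions of registers and states

unit : ℕ → ℕ → ℕ
unit r x = if ⌊ r ≟ x ⌋ then 1 else 0

unit-refl : ∀ r → unit r r ≡ 1
unit-refl r with r ≟ r
... | yes _ = refl
... | no ¬p = contradiction refl ¬p

unit-≢ : ∀ {r x} → r ≢ x → unit r x ≡ 0
unit-≢ {r} {x} r≢x with r ≟ x
... | yes e = contradiction e r≢x
... | no _ = refl

unit-≡ : ∀ r x → unit r x ≢ 0 → r ≡ x
unit-≡ r x ne with r ≟ x
... | yes e = e
... | no _ = contradiction refl ne

kind arg : St → ℕ
kind qin     = 0
kind qf      = 1
kind dead    = 2
kind pool    = 3
kind spent   = 4
kind down    = 5
kind (up r)  = 6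
kind (one r) = 7
kind (pc i)  = 8
kind (w i)   = 9
arg (up r)  = r
arg (one r) = r
arg (pc i)  = i
arg (w i)   = i
arg _       = 0

mk : ℕ → ℕ → St
mk 0 _ = qin
mk 1 _ = qf
mk 2 _ = dead
mk 3 _ = pool
mk 4 _ = spent
mk 5 _ = down
mk 6 r = up r
mk 7 r = one r
mk 8 i = pc i
mk _ i = w i

mk-kind-arg : ∀ s → mk (kind s) (arg s) ≡ s
mk-kind-arg qin     = refl
mk-kind-arg qf      = refl
mk-kind-arg dead    = refl
mk-kind-arg pool    = refl
mk-kind-arg spent   = refl
mk-kind-arg down    = refl
mk-kind-arg (up r)  = refl
mk-kind-arg (one r) = refl
mk-kind-arg (pc i)  = refl
mk-kind-arg (w i)   = refl

-- Comparing kinds before arguments makes `only s x` evaluate to 0 whenever the constructors differ,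
-- so most balance equations of the simulation simplify by computation.
only : St → St → ℕ
only s x = if kind s ≡ᵇ kind x then unit (arg s) (arg x) else 0

only-refl : ∀ s → only s s ≡ 1
only-refl s with kind s ≡ᵇ kind s in eq
... | true  = unit-refl (arg s)
... | false = contradiction (subst T eq (≡⇒≡ᵇ (kind s) (kind s) refl)) λ ()

only-≡ : ∀ s x → only s x ≢ 0 → s ≡ x
only-≡ s x ne with kind s ≡ᵇ kind x in eq
... | false = contradiction refl ne
... | true  = trans (sym (mk-kind-arg s)) (trans
  (cong₂ mk (≡ᵇ⇒≡ (kind s) (kind x) (subst T (sym eq) _)) (unit-≡ _ _ ne)) (mk-kind-arg x))

-- Nondeterministic counter machines given by a list of edges

data Op : Set where
  inc dec zero : ℕ → Op
  jump : Op

Edge : Set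
Edge = ℕ × Op × ℕ

-- Additive equations for the registers: the one for `dec` also says that the register was positive.
data Halts (E : List Edge) (h : ℕ) : ℕ → Regs → Set where
  halt : ∀ {R} → Halts E h h R
  inc  : ∀ {i r j R S} → (i , inc r , j) ∈ E → (∀ x → S x ≡ R x + unit r x) →
         Halts E h j S → Halts E h i R
  dec  : ∀ {i r j R S} → (i , dec r , j) ∈ E → (∀ x → R x ≡ S x + unit r x) →
         Halts E h j S → Halts E h i R
  zero : ∀ {i r j R} → (i , zero r , j) ∈ E → R r ≡ 0 → Halts E h j R → Halts E h i R
  jump : ∀ {i j R} → (i , jump , j) ∈ E → Halts E h j R → Halts E h i R

halts-cong : ∀ {E h i R S} → R ≗ S → Halts E h i R → Halts E h i S
halts-cong e halt = halt
halts-cong e (inc m eq p) = inc m (λ x → trans (eq x) (cong (_+ _) (e x))) p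
halts-cong e (dec m eq p) = dec m (λ x → trans (sym (e x)) (eq x)) p
halts-cong e (zero m z p) = zero m (trans (sym (e _)) z) (halts-cong e p)
halts-cong e (jump m p) = jump m (halts-cong e p)

data Tr (E : List Edge) (start h K : ℕ) : St → Act → St → Set where
  supply : Tr E start h K qin τ pool
  launch : Tr E start h K qin τ (pc start)
  jump   : ∀ {i j} → (i , jump , j) ∈ E → Tr E start h K (pc i) τ (pc j)
  inc!   : ∀ {i r j} → (i , inc r , j) ∈ E → Tr E start h K (pc i) (send (inc r)) (w j)
  dec!   : ∀ {i r j} → (i , dec r , j) ∈ E → Tr E start h K (pc i) (send (dec r)) (w j)
  zero!  : ∀ {i r j} → (i , zero r , j) ∈ E → Tr E start h K (pc i) (send (zero r)) (pc j)
  inc✓   : ∀ {i r j} → (i , inc r , j) ∈ E → Tr E start h K (w j) (recv ack) (pc j)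
  dec✓   : ∀ {i r j} → (i , dec r , j) ∈ E → Tr E start h K (w j) (recv ack) (pc j)
  inc?   : ∀ {r} → r < K → Tr E start h K pool (recv (inc r)) (up r)
  up!    : ∀ {r} → r < K → Tr E start h K (up r) (send ack) (one r)
  dec?   : ∀ {r} → r < K → Tr E start h K (one r) (recv (dec r)) down
  down!  : Tr E start h K down (send ack) spent
  zero?  : ∀ {r} → r < K → Tr E start h K (one r) (recv (zero r)) dead
  retire : Tr E start h K spent τ qf
  fin!   : Tr E start h K (pc h) (send fin) qf
  fin?   : Tr E start h K qf (recv fin) dead

active : St → Bool
active qin    = true
active spent  = true
active down   = true
active (up _) = true
active (pc _) = true
active _      = false

sender-active : ∀ {E start h K s m s′} → Tr E start h K s (send m) s′ → active s ≡ true
sender-active (inc! _)  = refl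
sender-active (dec! _)  = refl
sender-active (zero! _) = refl
sender-active (up! _)   = refl
sender-active down!     = refl
sender-active fin!      = refl

receiver-waiting : ∀ {E start h K s m s′} → Tr E start h K s (recv m) s′ → active s ≡ false
receiver-waiting (inc✓ _)  = refl
receiver-waiting (dec✓ _)  = refl
receiver-waiting (inc? _)  = refl
receiver-waiting (dec? _)  = refl
receiver-waiting (zero? _) = refl
receiver-waiting fin?      = refl

internal-active : ∀ {E start h K s s′} → Tr E start h K s τ s′ → active s ≡ true
internal-active supply   = refl
internal-active launch   = refl
internal-active (jump _) = refl
internal-active retire   = refl

-- From transitions between roles to a `Protocol`

cap : ∀ n → ℕ → Fin (suc n)
cap n       zero    = zero
cap zero    (suc x) = zero
cap (suc n) (suc x) = suc (cap n x)

toℕ-cap : ∀ {n x} → x ≤ n → toℕ (cap n x) ≡ x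
toℕ-cap {n}     {zero}  le       = refl
toℕ-cap {suc n} {suc x} (s≤s le) = cong suc (toℕ-cap le)

cap-toℕ : ∀ {n} (q : Fin (suc n)) → cap n (toℕ q) ≡ q
cap-toℕ {n} zero = refl
cap-toℕ {suc n} (suc q) = cong suc (cap-toℕ q)

encM-injective : ∀ {m m′} → encM m ≡ encM m′ → m ≡ m′
encM-injective {m} {m′} e = trans (sym (decM-encM m)) (trans (cong decM e) (decM-encM m′))

record Fits (Q : ℕ) (s : St) : Set where
  constructor fits
  field enc≤ : enc s ≤ Q
open Fits

BoundedA : ℕ → Act → Set
BoundedA n τ        = ⊤
BoundedA n (send m) = encM m ≤ n
BoundedA n (recv m) = encM m ≤ n

Bounded : ℕ → ℕ → Trans → Set
Bounded Q S (s , a , s′) = Fits Q s × BoundedA S a × Fits Q s′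

convA : ∀ S → Act → Action (suc S)
convA S τ        = τ
convA S (send m) = send (cap S (encM m))
convA S (recv m) = recv (cap S (encM m))

module Conv (Q S : ℕ) (TT : List Trans) (bounded : All (Bounded Q S) TT) where

  st : St → Fin (suc Q)
  st s = cap Q (enc s)

  conv : Trans → Fin (suc Q) × Action (suc S) × Fin (suc Q)
  conv (s , a , s′) = st s , convA S a , st s′

  protocol : Protocol
  protocol = record { nQ = suc Q ; nΣ = suc S ; qin = st qin ; qf = st qf ; T = map conv TT }

  role : Fin (suc Q) → St
  role q = dec′ (toℕ q)

  role-st : ∀ {s} → Fits Q s → role (st s) ≡ s
  role-st {s} le = trans (cong dec′ (toℕ-cap (le .enc≤))) (dec′-enc s)

  st-role : ∀ q → st (role q) ≡ q
  st-role q = trans (cong (cap Q) (enc-dec′ (toℕ q))) (cap-toℕ q)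

  only-role : ∀ {s} → Fits Q s → ∀ q → only s (role q) ≡ δ (st s) q
  only-role {s} le q with st s Fin.≟ q
  ... | yes refl = trans (cong (only s) (role-st le)) (only-refl s)
  ... | no ne with only s (role q) in eq
  ...   | zero  = refl
  ...   | suc _ = contradiction
    (trans (cong st (only-≡ s (role q) λ z → case-absurd (trans (sym eq) z))) (st-role q)) ne
    where
    case-absurd : ∀ {n} → suc n ≢ 0
    case-absurd ()

  opaque
    -- Numbers of leaders, helpers and dead processes, register contents and the occupation of one
    -- state are all such sums, for different weights f. Linearity lets one equation per step serve
    -- them all.
    W : (St → ℕ) → Config protocol → ℕ
    W f C = size (λ q → f (role q) * C q)

    W-δ : ∀ f {s} → Fits Q s → W f (δ (st s)) ≡ f s
    W-δ f {s} le = trans (size-δ (λ q → f (role q)) (st s)) (cong f (role-st le))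

    W-+ : ∀ f (X Y : Config protocol) → W f (λ q → X q + Y q) ≡ W f X + W f Y
    W-+ f X Y = trans (size-cong λ q → *-distribˡ-+ (f (role q)) (X q) (Y q)) (size-+ (λ q → f (role q) * X q) (λ q → f (role q) * Y q))

    W-cong : ∀ f {X Y : Config protocol} → X ≗ Y → W f X ≡ W f Y
    W-cong f e = size-cong λ q → cong (f (role q) *_) (e q)

    W-≤ : ∀ {f g} C → (∀ s → f s ≤ g s) → W f C ≤ W g C
    W-≤ C le = size-mono λ q → *-monoˡ-≤ (C q) (le (role q))

    W-++ : ∀ f g C → W (λ s → f s + g s) C ≡ W f C + W g C
    W-++ f g C = trans (size-cong λ q → *-distribʳ-+ (C q) (f (role q)) (g (role q))) (size-+ (λ q → f (role q) * C q) (λ q → g (role q) * C q))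

    W-zero : ∀ f C → (∀ q → f (role q) ≢ 0 → C q ≡ 0) → W f C ≡ 0
    W-zero f C z = size-zero λ q → vanish (f (role q)) (z q)
      where
      vanish : ∀ a {b} → (a ≢ 0 → b ≡ 0) → a * b ≡ 0
      vanish zero    h = refl
      vanish (suc a) h = trans (cong (suc a *_) (h λ ())) (*-zeroʳ a)

    occupied : ∀ {s} → Fits Q s → ∀ C → C (st s) ≡ W (only s) C
    occupied {s} le C = sym (trans (size-cong λ q → trans (*-comm _ (C q)) (cong (C q *_) (only-role le q))) (size-δ C (st s)))

    W-≥ : ∀ f C q → f (role q) * C q ≤ W f C
    W-≥ f C q = ≤-size (λ q → f (role q) * C q) q

  -- A step seen through its effect on all weighted sums at once, free of state numbers and of
  -- truncated subtraction.
  data AStep (C C′ : Config protocol) : Set where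
    int : ∀ {s s′} → (s , τ , s′) ∈ TT → W (only s) C > 0 →
          (∀ f → W f C′ + f s ≡ W f C + f s′) → AStep C C′
    rdv : ∀ {s₁ s₁′ s₂ s₂′ m} → (s₁ , send m , s₁′) ∈ TT → (s₂ , recv m , s₂′) ∈ TT →
          W (only s₁) C > 0 → W (only s₂) C > 0 →
          (∀ f → W f C′ + (f s₁ + f s₂) ≡ W f C + (f s₁′ + f s₂′)) → AStep C C′
    nbr : ∀ {s s′ m} → (s , send m , s′) ∈ TT → W (only s) C > 0 →
          (∀ {s₂ s₂′} → (s₂ , recv m , s₂′) ∈ TT → W (only s₂) C ≡ 0) →
          (∀ f → W f C′ + f s ≡ W f C + f s′) → AStep C C′

  WellPolarised : Set
  WellPolarised = (∀ {s m s′} → (s , send m , s′) ∈ TT → active s ≡ true)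
                × (∀ {s m s′} → (s , recv m , s′) ∈ TT → active s ≡ false)
                × (∀ {s s′} → (s , τ , s′) ∈ TT → active s ≡ true)

  -- Building runs requires explicit counts per role, whereas the backward analysis only looks at
  -- weighted sums.
  record _≈_ (C : Config protocol) (D : St → ℕ) : Set where
    constructor cells
    field cell : ∀ q → C q ≡ D (role q)
  open _≈_ public

  module _ (pol : WellPolarised) where

    bnd : ∀ {x} → x ∈ TT → Bounded Q S x
    bnd = All.lookup bounded

    -- A sender is active and a receiver is waiting. Their difference makes `move₂` subtract from
    -- two separate counts, and taking away the sender leaves the counts of possible receivers
    -- unchanged.
    st-≢ : ∀ {s₁ m s₁′ s₂ m₂ s₂′} → (s₁ , send m , s₁′) ∈ TT → (s₂ , recv m₂ , s₂′) ∈ TT → st s₁ ≢ st s₂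
    st-≢ {s₁} {s₂ = s₂} a b e with trans (sym (role-st (proj₁ (bnd a)))) (trans (cong role e) (role-st (proj₁ (bnd b))))
    ... | refl with trans (sym (proj₁ pol a)) (proj₁ (proj₂ pol) b)
    ...   | ()

    from-τ : ∀ {q q′} → (q , τ , q′) ∈ map conv TT →
             ∃ λ s → ∃ λ s′ → (s , τ , s′) ∈ TT × q ≡ st s × q′ ≡ st s′
    from-τ i with ∈-map⁻ conv i
    ... | (s , τ , s′) , i′ , refl = s , s′ , i′ , refl , refl

    from-send : ∀ {q n q′} → (q , send n , q′) ∈ map conv TT →
                ∃ λ s → ∃ λ m → ∃ λ s′ → (s , send m , s′) ∈ TT × q ≡ st s × n ≡ cap S (encM m) × q′ ≡ st s′
    from-send i with ∈-map⁻ conv i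
    ... | (s , send m , s′) , i′ , refl = s , m , s′ , i′ , refl , refl , refl

    from-recv : ∀ {q n q′} → (q , recv n , q′) ∈ map conv TT →
                ∃ λ s → ∃ λ m → ∃ λ s′ → (s , recv m , s′) ∈ TT × q ≡ st s × n ≡ cap S (encM m) × q′ ≡ st s′
    from-recv i with ∈-map⁻ conv i
    ... | (s , recv m , s′) , i′ , refl = s , m , s′ , i′ , refl , refl , refl

    same-message : ∀ {s m s′ s₂ m₂ s₂′} → (s , send m , s′) ∈ TT → (s₂ , recv m₂ , s₂′) ∈ TT →
                   cap S (encM m) ≡ cap S (encM m₂) → m ≡ m₂
    same-message a b e = encM-injective
      (trans (sym (toℕ-cap (proj₁ (proj₂ (bnd a))))) (trans (cong toℕ e) (toℕ-cap (proj₁ (proj₂ (bnd b))))))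

    waitOnly : WaitOnly protocol
    waitOnly = (λ q → active (role q)) , refl , waits , sends , taus
      where
      waits : ∀ {q m q′} → (q , recv m , q′) ∈ map conv TT → active (role q) ≡ false
      waits i with from-recv i
      ... | s , _ , _ , i′ , refl , _ = trans (cong active (role-st (proj₁ (bnd i′)))) (proj₁ (proj₂ pol) i′)
      sends : ∀ {q m q′} → (q , send m , q′) ∈ map conv TT → active (role q) ≡ true
      sends i with from-send i
      ... | s , _ , _ , i′ , refl , _ = trans (cong active (role-st (proj₁ (bnd i′)))) (proj₁ pol i′)
      taus : ∀ {q q′} → (q , τ , q′) ∈ map conv TT → active (role q) ≡ true
      taus i with from-τ i
      ... | s , _ , i′ , refl , _ = trans (cong active (role-st (proj₁ (bnd i′)))) (proj₂ (proj₂ pol) i′)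

    balance₁ : ∀ {s s′} C → Fits Q s → Fits Q s′ → C (st s) > 0 →
               ∀ f → W f (move₁ C (st s) (st s′)) + f s ≡ W f C + f s′
    balance₁ {s} {s′} C b b′ pos f = begin
      W f C′ + f s                     ≡⟨ cong (W f C′ +_) (sym (W-δ f b)) ⟩
      W f C′ + W f (δ (st s))          ≡⟨ sym (W-+ f C′ (δ (st s))) ⟩
      W f (λ q → C′ q + δ (st s) q)    ≡⟨ W-cong f (move₁-balance C (st s) (st s′) pos) ⟩
      W f (λ q → C q + δ (st s′) q)    ≡⟨ W-+ f C (δ (st s′)) ⟩
      W f C + W f (δ (st s′))          ≡⟨ cong (W f C +_) (W-δ f b′) ⟩
      W f C + f s′                     ∎
      where
      open ≡-Reasoning
      C′ = move₁ C (st s) (st s′)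

    balance₂ : ∀ {s₁ s₂ s₁′ s₂′} C → Fits Q s₁ → Fits Q s₂ → Fits Q s₁′ → Fits Q s₂′ →
               st s₁ ≢ st s₂ → C (st s₁) > 0 → C (st s₂) > 0 →
               ∀ f → W f (move₂ C (st s₁) (st s₂) (st s₁′) (st s₂′)) + (f s₁ + f s₂) ≡ W f C + (f s₁′ + f s₂′)
    balance₂ {s₁} {s₂} {s₁′} {s₂′} C b₁ b₂ b₁′ b₂′ ne pos₁ pos₂ f = begin
      W f C′ + (f s₁ + f s₂)                              ≡⟨ cong (W f C′ +_) (sym (two b₁ b₂)) ⟩
      W f C′ + W f (λ q → δ (st s₁) q + δ (st s₂) q)      ≡⟨ sym (W-+ f C′ (λ q → δ (st s₁) q + δ (st s₂) q)) ⟩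
      W f (λ q → C′ q + (δ (st s₁) q + δ (st s₂) q))      ≡⟨ W-cong f (move₂-balance C _ _ _ _ ne pos₁ pos₂) ⟩
      W f (λ q → C q + (δ (st s₁′) q + δ (st s₂′) q))     ≡⟨ W-+ f C (λ q → δ (st s₁′) q + δ (st s₂′) q) ⟩
      W f C + W f (λ q → δ (st s₁′) q + δ (st s₂′) q)     ≡⟨ cong (W f C +_) (two b₁′ b₂′) ⟩
      W f C + (f s₁′ + f s₂′)                             ∎
      where
      open ≡-Reasoning
      C′ = move₂ C (st s₁) (st s₂) (st s₁′) (st s₂′)
      two : ∀ {s t} → Fits Q s → Fits Q t → W f (λ q → δ (st s) q + δ (st t) q) ≡ f s + f t
      two {s} {t} b b′ = trans (W-+ f (δ (st s)) (δ (st t))) (cong₂ _+_ (W-δ f b) (W-δ f b′))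

    abstract-step : ∀ {C C′} → Step protocol C C′ → AStep C C′
    abstract-step {C} (internal i pos) with from-τ i
    ... | s , s′ , i′ , refl , refl =
      int i′ (subst (_> 0) (occupied b C) pos) (balance₁ C b b′ pos)
      where
      b = proj₁ (bnd i′)
      b′ = proj₂ (proj₂ (bnd i′))
    abstract-step {C} (rendezvous i₁ i₂ pos₁ pos₂ _) with from-send i₁ | from-recv i₂
    ... | s₁ , m₁ , s₁′ , j₁ , refl , refl , refl | s₂ , m₂ , s₂′ , j₂ , refl , e , refl
      with same-message j₁ j₂ e
    ... | refl = rdv j₁ j₂ (subst (_> 0) (occupied b₁ C) pos₁) (subst (_> 0) (occupied b₂ C) pos₂)
      (balance₂ C b₁ b₂ (proj₂ (proj₂ (bnd j₁))) (proj₂ (proj₂ (bnd j₂))) (st-≢ j₁ j₂) pos₁ pos₂)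
      where
      b₁ = proj₁ (bnd j₁)
      b₂ = proj₁ (bnd j₂)
    abstract-step {C} (nonblocking i pos none) with from-send i
    ... | s , m , s′ , j , refl , refl , refl =
      nbr j (subst (_> 0) (occupied b C) pos) none′ (balance₁ C b (proj₂ (proj₂ (bnd j))) pos)
      where
      b = proj₁ (bnd j)
      none′ : ∀ {s₂ s₂′} → (s₂ , recv m , s₂′) ∈ TT → W (only s₂) C ≡ 0
      none′ {s₂} k = trans (sym (occupied (proj₁ (bnd k)) C))
        (trans (cong (C (st s₂) ∸_) (sym (δ-≢ (st-≢ j k)))) (none (∈-map⁺ conv k)))

    step-int : ∀ {s s′ C} (B : St → ℕ) → (s , τ , s′) ∈ TT → C ≈ (λ x → B x + only s x) →
               ∃ λ C′ → Step protocol C C′ × C′ ≈ (λ x → B x + only s′ x)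
    step-int {s} {s′} {C} B i eq = _ , internal (∈-map⁺ conv i) pos , cells eq′
      where
      b = proj₁ (bnd i)
      b′ = proj₂ (proj₂ (bnd i))
      pos : C (st s) > 0
      pos = subst (_> 0) (sym (trans (eq .cell (st s)) (trans (cong (λ x → B x + only s x) (role-st b)) (cong (B s +_) (only-refl s))))) (m≤n+m 1 (B s))
      eq′ : ∀ q → move₁ C (st s) (st s′) q ≡ B (role q) + only s′ (role q)
      eq′ q = cong₂ _+_
        (trans (cong (_∸ δ (st s) q) (trans (eq .cell q) (cong (B (role q) +_) (only-role b q)))) (m+n∸n≡m (B (role q)) (δ (st s) q)))
        (sym (only-role b′ q))

    step-nbr : ∀ {s m s′ C} (B : St → ℕ) → (s , send m , s′) ∈ TT →
               (∀ {s₂ s₂′} → (s₂ , recv m , s₂′) ∈ TT → B s₂ ≡ 0) → C ≈ (λ x → B x + only s x) →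
               ∃ λ C′ → Step protocol C C′ × C′ ≈ (λ x → B x + only s′ x)
    step-nbr {s} {m} {s′} {C} B i none eq = _ , nonblocking (∈-map⁺ conv i) pos none′ , cells eq′
      where
      b = proj₁ (bnd i)
      b′ = proj₂ (proj₂ (bnd i))
      pos : C (st s) > 0
      pos = subst (_> 0) (sym (trans (eq .cell (st s)) (trans (cong (λ x → B x + only s x) (role-st b)) (cong (B s +_) (only-refl s))))) (m≤n+m 1 (B s))
      left : ∀ q → C q ∸ δ (st s) q ≡ B (role q)
      left q = trans (cong (_∸ δ (st s) q) (trans (eq .cell q) (cong (B (role q) +_) (only-role b q)))) (m+n∸n≡m (B (role q)) (δ (st s) q))
      eq′ : ∀ q → move₁ C (st s) (st s′) q ≡ B (role q) + only s′ (role q)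
      eq′ q = cong₂ _+_ (left q) (sym (only-role b′ q))
      none′ : ∀ {q₂ q₂′} → (q₂ , recv (cap S (encM m)) , q₂′) ∈ map conv TT → remove C (st s) q₂ ≡ 0
      none′ k with from-recv k
      ... | s₂ , m₂ , s₂′ , k′ , refl , e , refl with same-message i k′ e
      ...   | refl = trans (left (st s₂)) (trans (cong B (role-st (proj₁ (bnd k′)))) (none k′))

    step-rdv : ∀ {s₁ m s₁′ s₂ s₂′ C} (B : St → ℕ) → (s₁ , send m , s₁′) ∈ TT → (s₂ , recv m , s₂′) ∈ TT →
               C ≈ (λ x → B x + only s₂ x + only s₁ x) →
               ∃ λ C′ → Step protocol C C′ × C′ ≈ (λ x → B x + only s₁′ x + only s₂′ x)
    step-rdv {s₁} {m} {s₁′} {s₂} {s₂′} {C} B i₁ i₂ eq =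
      _ , rendezvous (∈-map⁺ conv i₁) (∈-map⁺ conv i₂) pos₁ pos₂ (+-mono-≤ pos₁ pos₂) , cells eq′
      where
      b₁ = proj₁ (bnd i₁)
      b₂ = proj₁ (bnd i₂)
      pos₁ : C (st s₁) > 0
      pos₁ = subst (_> 0) (sym (trans (eq .cell (st s₁)) (trans (cong (λ x → B x + only s₂ x + only s₁ x) (role-st b₁)) (cong (B s₁ + only s₂ s₁ +_) (only-refl s₁)))))
        (m≤n+m 1 (B s₁ + only s₂ s₁))
      pos₂ : C (st s₂) > 0
      pos₂ = subst (_> 0) (sym (trans (eq .cell (st s₂)) (trans (cong (λ x → B x + only s₂ x + only s₁ x) (role-st b₂)) (cong (λ u → B s₂ + u + only s₁ s₂) (only-refl s₂)))))
        (≤-trans (m≤n+m 1 (B s₂)) (m≤m+n _ _))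
      eq′ : ∀ q → move₂ C (st s₁) (st s₂) (st s₁′) (st s₂′) q ≡ B (role q) + only s₁′ (role q) + only s₂′ (role q)
      eq′ q = cong₂ _+_ (cong₂ _+_
        (trans (cong (λ u → u ∸ δ (st s₁) q ∸ δ (st s₂) q)
                 (trans (eq .cell q) (cong₂ _+_ (cong (B (role q) +_) (only-role b₂ q)) (only-role b₁ q))))
          (trans (cong (_∸ δ (st s₂) q) (m+n∸n≡m (B (role q) + δ (st s₂) q) (δ (st s₁) q))) (m+n∸n≡m (B (role q)) (δ (st s₂) q))))
        (sym (only-role (proj₂ (proj₂ (bnd i₁))) q)))
        (sym (only-role (proj₂ (proj₂ (bnd i₂))) q))

-- Weights for the invariant

isDead isLeader isFinal isHelper isBusy : St → ℕ
isDead dead = 1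
isDead _    = 0
isLeader (pc _) = 1
isLeader (w _)  = 1
isLeader _      = 0
isFinal qf = 1
isFinal _  = 0
isHelper (up _) = 1
isHelper down   = 1
isHelper _      = 0
isBusy qin  = 0
isBusy pool = 0
isBusy _    = 1

-- `up r` already counts and `down` no longer does, so a register changes at the rendez-vous that
-- opens an operation and not at the acknowledgement.
holds : ℕ → St → ℕ
holds x (up r)  = unit r x
holds x (one r) = unit r x
holds x _       = 0

unit-≤1 : ∀ r x → unit r x ≤ 1
unit-≤1 r x with r ≟ x
... | yes _ = ≤-refl
... | no _  = z≤n

holds≤busy : ∀ x s → holds x s ≤ isBusy s
holds≤busy x qin     = z≤n
holds≤busy x qf      = z≤n
holds≤busy x dead    = z≤n
holds≤busy x pool    = z≤n
holds≤busy x spent   = z≤n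
holds≤busy x down    = z≤n
holds≤busy x (up r)  = unit-≤1 r x
holds≤busy x (one r) = unit-≤1 r x
holds≤busy x (pc i)  = z≤n
holds≤busy x (w i)   = z≤n

helper≤busy : ∀ s → isHelper s ≤ isBusy s
helper≤busy qin     = z≤n
helper≤busy qf      = z≤n
helper≤busy dead    = z≤n
helper≤busy pool    = z≤n
helper≤busy spent   = z≤n
helper≤busy down    = ≤-refl
helper≤busy (up r)  = ≤-refl
helper≤busy (one r) = z≤n
helper≤busy (pc i)  = z≤n
helper≤busy (w i)   = z≤n

only≤ : ∀ (f : St → ℕ) s → 1 ≤ f s → ∀ x → only s x ≤ f x
only≤ f s 1≤ x with only s x in eq
... | zero = z≤n
... | suc n with only-≡ s x (λ z → contradiction (trans (sym eq) z) λ ())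
...   | refl = subst (_≤ f s) (trans (sym (only-refl s)) eq) 1≤

two-only≤ : ∀ (f : St → ℕ) s t → s ≢ t → 1 ≤ f s → 1 ≤ f t → ∀ x → only s x + only t x ≤ f x
two-only≤ f s t s≢t 1≤s 1≤t x with only s x in eq
... | zero = only≤ f t 1≤t x
... | suc n with only-≡ s x (λ z → contradiction (trans (sym eq) z) λ ())
...   | refl with only t s in eq′
...     | zero = subst (_≤ f s) (trans (sym (only-refl s)) (trans eq (sym (+-identityʳ (suc n))))) 1≤s
...     | suc _ = contradiction (sym (only-≡ t s (λ z → contradiction (trans (sym eq′) z) λ ()))) s≢t

cancel : ∀ k {x y} → x + k ≡ y + k → x ≡ y
cancel k {x} {y} = +-cancelʳ-≡ k x y

-- Correctness of the simulation

module Simulation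
  (Q S : ℕ) (TT : List Trans) (bounded : All (Bounded Q S) TT)
  (E : List Edge) (start h K : ℕ)
  (sound : ∀ {s a s′} → (s , a , s′) ∈ TT → Tr E start h K s a s′)
  (complete : ∀ {s a s′} → Tr E start h K s a s′ → (s , a , s′) ∈ TT)
  (inc<K : ∀ {i r j} → (i , inc r , j) ∈ E → r < K)
  (dec<K : ∀ {i r j} → (i , dec r , j) ∈ E → r < K)
  (zero<K : ∀ {i r j} → (i , zero r , j) ∈ E → r < K)
  (clear∈E : ∀ {r} → r < K → (h , dec r , h) ∈ E)
  where

  open Conv Q S TT bounded public

  polarised : WellPolarised
  polarised = (λ i → sender-active (sound i)) , (λ i → receiver-waiting (sound i)) , (λ i → internal-active (sound i))

  isWaitOnly : WaitOnly protocol
  isWaitOnly = waitOnly polarised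

  Cfg : Set
  Cfg = Config protocol

  regs : Cfg → Regs
  regs C x = W (holds x) C

  -- Necessary conditions for reaching a final configuration, proved backwards from it; the
  -- clause idle is the one that applies to an initial configuration.
  record Good (C : Cfg) : Set where
    field
      noDead    : W isDead C ≡ 0
      oneLeader : W isLeader C ≤ 1
      notYet    : W isLeader C ≥ 1 → W isFinal C ≡ 0
      atPc      : ∀ i → W (only (pc i)) C > 0 → W isHelper C ≡ 0 → Halts E h i (regs C)
      atW       : ∀ j → W (only (w j)) C > 0 →
                  W isHelper C ≥ 1 × (W isHelper C ≡ 1 → Halts E h j (regs C))
      idle      : W isBusy C ≡ 0 → Halts E h start (λ _ → 0)
  open Good

  only-≤-W : ∀ f s C → 1 ≤ f s → W (only s) C ≤ W f C
  only-≤-W f s C 1≤ = W-≤ C (only≤ f s 1≤)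

  -- Two different occupied leader states would contribute at least 2 to a sum bounded by 1.
  unique : ∀ C s t → W isLeader C ≤ 1 → 1 ≤ isLeader s → 1 ≤ isLeader t →
           W (only s) C > 0 → W (only t) C > 0 → ¬ s ≢ t
  unique C s t le 1≤s 1≤t ps pt s≢t = contradiction
    (≤-trans (≤-trans (+-mono-≤ ps pt) (≤-reflexive (sym (W-++ (only s) (only t) C))))
      (≤-trans (W-≤ C (two-only≤ isLeader s t s≢t 1≤s 1≤t)) le))
    λ { (s≤s ()) }

  pc-pc : ∀ C {i j} → W isLeader C ≤ 1 → W (only (pc i)) C > 0 → W (only (pc j)) C > 0 → i ≡ j
  pc-pc C {i} {j} le a b with i ≟ j
  ... | yes e = e
  ... | no ne = contradiction (λ { refl → ne refl }) (unique C (pc i) (pc j) le ≤-refl ≤-refl a b)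

  w-w : ∀ C {i j} → W isLeader C ≤ 1 → W (only (w i)) C > 0 → W (only (w j)) C > 0 → i ≡ j
  w-w C {i} {j} le a b with i ≟ j
  ... | yes e = e
  ... | no ne = contradiction (λ { refl → ne refl }) (unique C (w i) (w j) le ≤-refl ≤-refl a b)

  pc-w : ∀ C {i j} {A : Set} → W isLeader C ≤ 1 → W (only (pc i)) C > 0 → W (only (w j)) C > 0 → A
  pc-w C {i} {j} le a b = contradiction (λ ()) (unique C (pc i) (w j) le ≤-refl ≤-refl a b)

  good-final : ∀ C → Final protocol C → Good C
  good-final C (pos , others) = record
    { noDead = none isDead refl ; oneLeader = ≤-trans (≤-reflexive (none isLeader refl)) z≤n
    ; notYet = λ p → absurd (none isLeader refl) p
    ; atPc = λ i p _ → absurd (none (only (pc i)) refl) p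
    ; atW = λ j p → absurd (none (only (w j)) refl) p
    -- `qf` counts as busy, so without busy processes the configuration would be empty.
    ; idle = λ z → contradiction (subst (_> 0) (size-zero (empty z)) pos) λ () }
    where
    absurd : ∀ {n} {A : Set} → n ≡ 0 → n > 0 → A
    absurd refl ()
    role≡qf : ∀ {q} → q ≡ st qf → 1 ≤ Q → role q ≡ qf
    role≡qf refl 1≤Q = role-st (fits 1≤Q)
    1≤Q : 1 ≤ Q
    1≤Q = Fits.enc≤ (proj₂ (proj₂ (All.lookup bounded (complete retire))))
    none : ∀ f → f qf ≡ 0 → W f C ≡ 0
    none f fz = W-zero f C λ q ne → others q λ e → ne (trans (cong f (role≡qf e 1≤Q)) fz)
    empty : W isBusy C ≡ 0 → ∀ q → C q ≡ 0
    empty z q with q Fin.≟ st qf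
    ... | no ne = others q ne
    ... | yes e = n≤0⇒n≡0 (≤-trans (≤-reflexive (sym (trans
      (cong (λ s → isBusy s * C q) (role≡qf e 1≤Q)) (+-identityʳ (C q)))))
      (≤-trans (W-≥ isBusy C q) (≤-reflexive z)))

  module _ {C C′ : Cfg} (G : Good C′) where

    not-idle : ∀ {A : Set} s → 1 ≤ isBusy s → W (only s) C > 0 → W isBusy C ≡ 0 → A
    not-idle s 1≤ p z = contradiction (≤-trans p (≤-trans (only-≤-W isBusy s C 1≤) (≤-reflexive z))) λ ()

    grow : ∀ {x y k} → x + 0 ≡ y + k → k > 0 → x > 0
    grow {x} {y} {k} e p = subst (_> 0) (trans (sym e) (+-identityʳ x)) (≤-trans p (m≤n+m k y))

    dead-absurd : ∀ {A : Set} → W isDead C′ + 0 ≡ W isDead C + 1 → A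
    dead-absurd e = contradiction (noDead G) (>⇒≢ (grow e ≤-refl))

    good-supply : (∀ f → W f C′ + f qin ≡ W f C + f pool) → Good C
    good-supply bal = record
      { noDead = trans (sym (same isDead refl)) (noDead G)
      ; oneLeader = subst (_≤ 1) (same isLeader refl) (oneLeader G)
      ; notYet = λ p → trans (sym (same isFinal refl)) (notYet G (subst (_≥ 1) (sym (same isLeader refl)) p))
      ; atPc = λ i p z → halts-cong (λ x → same (holds x) refl)
          (atPc G i (subst (_> 0) (sym (same (only (pc i)) refl)) p) (trans (same isHelper refl) z))
      ; atW = λ j p → let (a , b) = atW G j (subst (_> 0) (sym (same (only (w j)) refl)) p) in
          subst (_≥ 1) (same isHelper refl) a , λ e → halts-cong (λ x → same (holds x) refl) (b (trans (same isHelper refl) e))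
      ; idle = λ z → idle G (trans (same isBusy refl) z) }
      where
      same : ∀ f → f qin ≡ f pool → W f C′ ≡ W f C
      same f e = cancel (f qin) (trans (bal f) (cong (W f C +_) (sym e)))

    -- Every clause about a leader is vacuous. This covers `launch` and `retire`, the steps before
    -- which there is provably no leader.
    leaderless : W isLeader C ≡ 0 → W isDead C ≡ W isDead C′ → (W isBusy C ≡ 0 → Halts E h start (λ _ → 0)) → Good C
    leaderless none dead≡ idl = record
      { noDead = trans dead≡ (noDead G) ; oneLeader = ≤-trans (≤-reflexive none) z≤n
      ; notYet = λ p → contradiction none (>⇒≢ p)
      ; atPc = λ i p _ → contradiction (≤-trans p (≤-trans (only-≤-W isLeader (pc i) C ≤-refl) (≤-reflexive none))) λ ()
      ; atW = λ j p → contradiction (≤-trans p (≤-trans (only-≤-W isLeader (w j) C ≤-refl) (≤-reflexive none))) λ ()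
      ; idle = idl }

    -- At most one leader exists after the step, so none did before. If moreover nobody was busy,
    -- then all registers are zero and no helper is around, and `atPc` at `start` yields what `idle`
    -- claims.
    good-launch : (∀ f → W f C′ + f qin ≡ W f C + f (pc start)) → Good C
    good-launch bal = leaderless
      (n≤0⇒n≡0 (+-cancelʳ-≤ 1 _ 0 (≤-trans (≤-reflexive (trans (sym (bal isLeader)) (+-identityʳ _))) (oneLeader G))))
      (sym (cancel 0 (bal isDead)))
      λ z → halts-cong (λ x → trans (cancel 0 (bal (holds x))) (below-busy z (holds x) (holds≤busy x)))
        (atPc G start (grow (bal (only (pc start))) (≤-reflexive (sym (only-refl (pc start)))))
          (trans (cancel 0 (bal isHelper)) (below-busy z isHelper helper≤busy)))
      where
      below-busy : W isBusy C ≡ 0 → ∀ f → (∀ s → f s ≤ isBusy s) → W f C ≡ 0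
      below-busy z f le = n≤0⇒n≡0 (≤-trans (W-≤ C le) (≤-reflexive z))

    no-leader-left : W isFinal C′ > 0 → W isLeader C′ ≡ 0
    no-leader-left p with W isLeader C′ in eq
    ... | zero = refl
    ... | suc _ = contradiction (notYet G (≤-trans z<s (≤-reflexive (sym eq)))) (>⇒≢ p)

    -- Somebody is in `qf` afterwards, so `notYet` leaves no room for a leader.
    good-retire : (∀ f → W f C′ + f spent ≡ W f C + f qf) → W (only spent) C > 0 → Good C
    good-retire bal p = leaderless
      (trans (sym (cancel 0 (bal isLeader))) (no-leader-left (grow (bal isFinal) ≤-refl)))
      (sym (cancel 0 (bal isDead)))
      (not-idle spent ≤-refl p)

    leader-step : ∀ i → W (only (pc i)) C > 0 → W isDead C′ ≡ W isDead C → W isLeader C′ ≡ W isLeader C →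
                  W isFinal C′ ≡ W isFinal C → (W isHelper C ≡ 0 → Halts E h i (regs C)) → Good C
    leader-step i occ dead≡ leader≡ final≡ halts = record
      { noDead = trans (sym dead≡) (noDead G) ; oneLeader = one≤
      ; notYet = λ p → trans (sym final≡) (notYet G (subst (_≥ 1) (sym leader≡) p))
      ; atPc = λ i′ p z → subst (λ i → Halts E h i (regs C)) (pc-pc C one≤ occ p) (halts z)
      ; atW = λ j p → pc-w C one≤ occ p
      ; idle = not-idle (pc i) ≤-refl occ }
      where
      one≤ : W isLeader C ≤ 1
      one≤ = subst (_≤ 1) leader≡ (oneLeader G)

    good-goto : ∀ i j → W (only (pc i)) C > 0 → (∀ f → W f C′ + f (pc i) ≡ W f C + f (pc j)) →
                (W isHelper C ≡ 0 → Halts E h j (regs C) → Halts E h i (regs C)) → Good C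
    good-goto i j occ bal back = leader-step i occ
      (cancel 0 (bal isDead)) (cancel 1 (bal isLeader)) (cancel 0 (bal isFinal))
      λ z → back z (halts-cong (λ x → cancel 0 (bal (holds x)))
        (atPc G j arrived (trans (cancel 0 (bal isHelper)) z)))
      where
      -- If j is i, the weight of `pc j` does not grow and the old occupation is reused.
      arrived : W (only (pc j)) C′ > 0
      arrived with bal (only (pc j))
      ... | eq with only (pc j) (pc i) in u
      ...   | zero = grow eq (≤-reflexive (sym (only-refl (pc j))))
      ...   | suc n with only-≡ (pc j) (pc i) (λ z → contradiction (trans (sym u) z) λ ())
      ...     | refl = subst (_> 0) (sym (cancel (suc n) (trans eq (cong (W (only (pc j)) C +_) u)))) occ

    -- An answered request creates one helper: no helper before, as `atPc` supposes, becomes exactly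
    -- one afterwards, as the second part of `atW` supposes.
    good-request : ∀ i j → W (only (pc i)) C > 0 →
                   W isDead C′ ≡ W isDead C → W isLeader C′ ≡ W isLeader C → W isFinal C′ ≡ W isFinal C →
                   W (only (w j)) C′ + 0 ≡ W (only (w j)) C + only (w j) (w j) →
                   W isHelper C′ ≡ suc (W isHelper C) →
                   (Halts E h j (regs C′) → Halts E h i (regs C)) → Good C
    good-request i j occ dead≡ leader≡ final≡ moved helper≡ back = leader-step i occ dead≡ leader≡ final≡
      λ z → back (proj₂ (atW G j (grow moved (≤-reflexive (sym (only-refl (w j)))))) (trans helper≡ (cong suc z)))

    -- A lost request creates no helper, yet by `atW` the leader now waiting needs one. So there was
    -- a stray helper already, and `atPc` claims nothing in that case.
    good-unanswered : ∀ i j → W (only (pc i)) C > 0 → (∀ f → W f C′ + f (pc i) ≡ W f C + f (w j)) → Good C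
    good-unanswered i j occ bal = leader-step i occ
      (cancel 0 (bal isDead)) (cancel 1 (bal isLeader)) (cancel 0 (bal isFinal))
      λ z → contradiction (trans (cancel 0 (bal isHelper)) z)
        (>⇒≢ (proj₁ (atW G j (grow (bal (only (w j))) (≤-reflexive (sym (only-refl (w j))))))))

    -- The answering process stops being a helper. If it was the only one, none is left, and `atPc`
    -- applies after the step with the same registers.
    good-ack : ∀ j → W (only (w j)) C > 0 →
               W isDead C′ ≡ W isDead C → W isLeader C′ ≡ W isLeader C → W isFinal C′ ≡ W isFinal C →
               W (only (pc j)) C′ + 0 ≡ W (only (pc j)) C + only (pc j) (pc j) →
               W isHelper C ≡ suc (W isHelper C′) → (∀ x → regs C′ x ≡ regs C x) → Good C
    good-ack j occ dead≡ leader≡ final≡ moved helper≡ regs≡ = record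
      { noDead = trans (sym dead≡) (noDead G) ; oneLeader = one≤
      ; notYet = λ p → trans (sym final≡) (notYet G (subst (_≥ 1) (sym leader≡) p))
      ; atPc = λ i p _ → pc-w C one≤ p occ
      ; atW = λ j′ p → subst (_≥ 1) (sym helper≡) (s≤s z≤n) ,
          λ e → subst (λ j → Halts E h j (regs C)) (w-w C one≤ occ p)
            (halts-cong regs≡ (atPc G j (grow moved (≤-reflexive (sym (only-refl (pc j)))))
              (suc-injective (trans (sym helper≡) e))))
      ; idle = not-idle (w j) ≤-refl occ }
      where
      one≤ : W isLeader C ≤ 1
      one≤ = subst (_≤ 1) leader≡ (oneLeader G)

    -- An acknowledgement into the void uses up a helper. Had it been the only one, a leader still
    -- waiting would be left without any, against `atW` after the step.
    good-unheard : ∀ s → W (only s) C > 0 → 1 ≤ isHelper s → 1 ≤ isBusy s →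
                   W isDead C′ ≡ W isDead C → W isLeader C′ ≡ W isLeader C → W isFinal C′ ≡ W isFinal C →
                   (∀ j → W (only (w j)) C′ ≡ W (only (w j)) C) →
                   W isHelper C ≡ suc (W isHelper C′) → Good C
    good-unheard s occ 1≤h 1≤b dead≡ leader≡ final≡ stay helper≡ = record
      { noDead = trans (sym dead≡) (noDead G) ; oneLeader = subst (_≤ 1) leader≡ (oneLeader G)
      ; notYet = λ p → trans (sym final≡) (notYet G (subst (_≥ 1) (sym leader≡) p))
      ; atPc = λ i p z → contradiction z (>⇒≢ helping)
      ; atW = λ j p → helping , λ e → contradiction (suc-injective (trans (sym helper≡) e))
          (>⇒≢ (proj₁ (atW G j (subst (_> 0) (sym (stay j)) p))))
      ; idle = not-idle s 1≤b occ }
      where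
      helping : W isHelper C > 0
      helping = ≤-trans occ (only-≤-W isHelper s C 1≤h)

    -- The unheard request shows that `qf` was empty before. It is occupied afterwards, so `notYet`
    -- leaves no leader behind, and the departing one was alone.
    good-fin : W (only (pc h)) C > 0 → W (only qf) C ≡ 0 → (∀ f → W f C′ + f (pc h) ≡ W f C + f qf) → Good C
    good-fin occ none bal = record
      { noDead = trans (sym (cancel 0 (bal isDead))) (noDead G) ; oneLeader = one≤
      ; notYet = λ _ → n≤0⇒n≡0 (≤-trans (W-≤ C final≤) (≤-reflexive none))
      ; atPc = λ i p _ → subst (λ i → Halts E h i (regs C)) (pc-pc C one≤ occ p) halt
      ; atW = λ j p → pc-w C one≤ occ p
      ; idle = not-idle (pc h) ≤-refl occ }
      where
      one≤ : W isLeader C ≤ 1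
      one≤ = ≤-reflexive (trans (sym (+-identityʳ _)) (trans (sym (bal isLeader))
        (cong (_+ 1) (no-leader-left (grow (bal isFinal) ≤-refl)))))
      final≤ : ∀ s → isFinal s ≤ only qf s
      final≤ qf      = ≤-refl
      final≤ qin     = z≤n
      final≤ dead    = z≤n
      final≤ pool    = z≤n
      final≤ spent   = z≤n
      final≤ down    = z≤n
      final≤ (up r)  = z≤n
      final≤ (one r) = z≤n
      final≤ (pc i)  = z≤n
      final≤ (w i)   = z≤n

    -- A unit of r sits in `one r`, where it would have received the request, or in `up r`, where it
    -- is a helper.
    unheld : ∀ r → W isHelper C ≡ 0 → W (only (one r)) C ≡ 0 → regs C r ≡ 0
    unheld r z z′ = n≤0⇒n≡0 (≤-trans (W-≤ C le)
      (≤-reflexive (trans (W-++ isHelper (only (one r)) C) (cong₂ _+_ z z′))))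
      where
      le : ∀ s → holds r s ≤ isHelper s + only (one r) s
      le qin     = z≤n
      le qf      = z≤n
      le dead    = z≤n
      le pool    = z≤n
      le spent   = z≤n
      le down    = z≤n
      le (up x)  = ≤-trans (unit-≤1 x r) (m≤m+n 1 _)
      le (one x) with x ≟ r
      ... | yes refl = ≤-reflexive (sym (unit-refl r))
      ... | no _ = z≤n
      le (pc i)  = z≤n
      le (w i)   = z≤n

    plus1 : ∀ {x y} → x + 0 ≡ y + 1 → x ≡ suc y
    plus1 {x} {y} e = trans (sym (+-identityʳ x)) (trans e (+-comm y 1))

    acked-up : ∀ r j → W (only (w j)) C > 0 →
               (∀ f → W f C′ + (f (up r) + f (w j)) ≡ W f C + (f (one r) + f (pc j))) → Good C
    acked-up r j occ bal = good-ack j occ (cancel 0 (bal isDead)) (cancel 1 (bal isLeader))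
      (cancel 0 (bal isFinal)) (bal (only (pc j))) (plus1 (sym (bal isHelper))) (λ x → cancel _ (bal (holds x)))

    acked-down : ∀ j → W (only (w j)) C > 0 →
                 (∀ f → W f C′ + (f down + f (w j)) ≡ W f C + (f spent + f (pc j))) → Good C
    acked-down j occ bal = good-ack j occ (cancel 0 (bal isDead)) (cancel 1 (bal isLeader))
      (cancel 0 (bal isFinal)) (bal (only (pc j))) (plus1 (sym (bal isHelper))) (λ x → cancel 0 (bal (holds x)))

    good-step : AStep C C′ → Good C
    good-step (int i occ bal) with sound i
    ... | supply = good-supply bal
    ... | launch = good-launch bal
    ... | jump m = good-goto _ _ occ bal λ _ → jump m
    ... | retire = good-retire bal occ
    good-step (nbr i occ none bal) with sound i
    ... | inc! m = good-unanswered _ _ occ bal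
    ... | dec! m = good-unanswered _ _ occ bal
    ... | zero! m = good-goto _ _ occ bal λ z → zero m (unheld _ z (none (complete (zero? (zero<K m)))))
    ... | up! {r} _ = good-unheard (up r) occ ≤-refl ≤-refl (cancel 0 (bal isDead)) (cancel 0 (bal isLeader))
      (cancel 0 (bal isFinal)) (λ j → cancel 0 (bal (only (w j)))) (plus1 (sym (bal isHelper)))
    ... | down! = good-unheard down occ ≤-refl ≤-refl (cancel 0 (bal isDead)) (cancel 0 (bal isLeader))
      (cancel 0 (bal isFinal)) (λ j → cancel 0 (bal (only (w j)))) (plus1 (sym (bal isHelper)))
    ... | fin! = good-fin occ (none (complete fin?)) bal
    good-step (rdv i₁ i₂ occ₁ occ₂ bal) with sound i₁ | sound i₂
    ... | inc! {i} {r} {j} m | inc? _ = good-request i j occ₁ (cancel 0 (bal isDead)) (cancel 1 (bal isLeader))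
      (cancel 0 (bal isFinal)) (trans (bal (only (w j))) (cong (W (only (w j)) C +_) (+-identityʳ _)))
      (plus1 (bal isHelper)) (inc m λ x → trans (sym (+-identityʳ _)) (bal (holds x)))
    ... | dec! {i} {r} {j} m | dec? _ = good-request i j occ₁ (cancel 0 (bal isDead)) (cancel 1 (bal isLeader))
      (cancel 0 (bal isFinal)) (trans (bal (only (w j))) (cong (W (only (w j)) C +_) (+-identityʳ _)))
      (plus1 (bal isHelper)) (dec m λ x → trans (sym (+-identityʳ _)) (sym (bal (holds x))))
    ... | zero! _ | zero? _ = dead-absurd (bal isDead)
    ... | fin! | fin? = dead-absurd (bal isDead)
    -- Acknowledgements carry no register, so any helper may release any waiting leader; all four
    -- combinations occur.
    ... | up! {r} _ | inc✓ {j = j} _ = acked-up r j occ₂ bal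
    ... | up! {r} _ | dec✓ {j = j} _ = acked-up r j occ₂ bal
    ... | down! | inc✓ {j = j} _ = acked-down j occ₂ bal
    ... | down! | dec✓ {j = j} _ = acked-down j occ₂ bal

  good : ∀ {C C′} → Final protocol C′ → Reach protocol C C′ → Good C
  good final ε = good-final _ final
  good final (s ◅ r) = good-step (good final r) (abstract-step polarised s)

  synchro⇒halts : Synchro protocol → Halts E h start (λ _ → 0)
  synchro⇒halts (C₀ , C_f , (_ , initial) , final , reach) = idle (good final reach)
    (W-zero isBusy C₀ λ q ne → initial q λ { refl → ne refl })

  -- From a halting computation to a run of the protocol

  CanFinish : Cfg → Set
  CanFinish C = ∃ λ C′ → Final protocol C′ × Reach protocol C C′

  infixr 1 _then_

  _then_ : ∀ {C D} → (∃ λ C′ → Step protocol C C′ × C′ ≈ D) → (∀ {C′} → C′ ≈ D → CanFinish C′) → CanFinish C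
  (C′ , s , c) then k = let (C″ , final , r) = k c in C″ , final , s ◅ r

  ones : Regs → St → ℕ
  ones R (one r) = R r
  ones R _       = 0

  ones-add : ∀ {R S} r → (∀ x → S x ≡ R x + unit r x) → ∀ s → ones S s ≡ ones R s + only (one r) s
  ones-add r e (one x) = e x
  ones-add r e qin     = refl
  ones-add r e qf      = refl
  ones-add r e dead    = refl
  ones-add r e pool    = refl
  ones-add r e spent   = refl
  ones-add r e down    = refl
  ones-add r e (up x)  = refl
  ones-add r e (pc x)  = refl
  ones-add r e (w x)   = refl

  ones-zero : ∀ {R} → (∀ x → R x ≡ 0) → ∀ s → ones R s ≡ 0
  ones-zero e (one x) = e x
  ones-zero e qin     = refl
  ones-zero e qf      = refl
  ones-zero e dead    = refl
  ones-zero e pool    = refl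
  ones-zero e spent   = refl
  ones-zero e down    = refl
  ones-zero e (up x)  = refl
  ones-zero e (pc x)  = refl
  ones-zero e (w x)   = refl

  -- k processes still available for increments, z units already given back
  crowd : ℕ → Regs → ℕ → St → ℕ
  crowd k R z x = k * only pool x + (ones R x + z * only spent x)

  record Leading (C : Cfg) (i k : ℕ) (R : Regs) (z : ℕ) : Set where
    constructor leading
    field crowded : C ≈ (λ x → crowd k R z x + only (pc i) x)

  ≈-trans : ∀ {C : Cfg} {D D′ : St → ℕ} → C ≈ D → (∀ x → D x ≡ D′ x) → C ≈ D′
  ≈-trans e e′ = cells λ q → trans (e .cell q) (e′ (role q))

  after-inc : ∀ {C i r j k R S z} → (i , inc r , j) ∈ E → (∀ x → S x ≡ R x + unit r x) →
              (∀ {C′} → Leading C′ j k S z → CanFinish C′) → Leading C i (suc k) R z → CanFinish C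
  after-inc {C} {i} {r} {j} {k} {R} {S} {z} m e done (leading c) =
    step-rdv polarised (crowd k R z) (complete (inc! m)) (complete (inc? (inc<K m)))
      (≈-trans c λ x → lemma₁ k (only pool x) (ones R x) (z * only spent x) (only (pc i) x))
    then λ c₁ → step-rdv polarised (crowd k R z) (complete (up! (inc<K m))) (complete (inc✓ m)) c₁
    then λ c₂ → done (leading (≈-trans c₂ λ x → trans
      (lemma₂ (k * only pool x) (ones R x) (z * only spent x) (only (one r) x) (only (pc j) x))
      (cong (λ u → (k * only pool x + (u + z * only spent x)) + only (pc j) x) (sym (ones-add r e x)))))
    where
    lemma₁ : ∀ k p o s l → (p + k * p) + (o + s) + l ≡ (k * p + (o + s)) + p + l
    lemma₁ = solve-∀
    lemma₂ : ∀ k o s q l → (k + (o + s)) + q + l ≡ (k + ((o + q) + s)) + l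
    lemma₂ = solve-∀

  after-dec : ∀ {C i r j k R S z} → (i , dec r , j) ∈ E → (∀ x → R x ≡ S x + unit r x) →
              (∀ {C′} → Leading C′ j k S (suc z) → CanFinish C′) → Leading C i k R z → CanFinish C
  after-dec {C} {i} {r} {j} {k} {R} {S} {z} m e done (leading c) =
    step-rdv polarised (crowd k S z) (complete (dec! m)) (complete (dec? (dec<K m)))
      (≈-trans c λ x → trans
        (cong (λ u → (k * only pool x + (u + z * only spent x)) + only (pc i) x) (ones-add r e x))
        (lemma₁ (k * only pool x) (ones S x) (z * only spent x) (only (one r) x) (only (pc i) x)))
    then λ c₁ → step-rdv polarised (crowd k S z) (complete down!) (complete (dec✓ m)) c₁
    then λ c₂ → done (leading (≈-trans c₂ λ x →
      lemma₂ (k * only pool x) (ones S x) z (only spent x) (only (pc j) x)))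
    where
    lemma₁ : ∀ k o s q l → (k + ((o + q) + s)) + l ≡ (k + (o + s)) + q + l
    lemma₁ = solve-∀
    lemma₂ : ∀ k o z s l → (k + (o + z * s)) + s + l ≡ (k + (o + (s + z * s))) + l
    lemma₂ = solve-∀

  -- Retirement is postponed until the leader has left, as its request would kill anybody in `qf`.
  -- The leader is the first process there, hence `suc y`.
  gather : ∀ z y {C} → C ≈ (λ x → z * only spent x + suc y * only qf x) → CanFinish C
  gather zero y {C} c = C , (nonempty , elsewhere) , ε
    where
    qf-fits : Fits Q qf
    qf-fits = proj₂ (proj₂ (All.lookup bounded (complete retire)))
    nonempty : size C > 0
    nonempty = ≤-trans (subst (_> 0) (sym (trans (c .cell (st qf))
      (cong (λ s → suc y * only qf s) (role-st qf-fits)))) (s≤s z≤n)) (≤-size C (st qf))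
    elsewhere : ∀ q → q ≢ st qf → C q ≡ 0
    elsewhere q ne = trans (c .cell q) (trans
      (cong (suc y *_) (trans (only-role qf-fits q) (δ-≢ (≢-sym ne)))) (*-zeroʳ y))
  gather (suc z) y c =
    step-int polarised (λ x → z * only spent x + suc y * only qf x) (complete retire)
      (≈-trans c λ x → lemma₁ (only spent x) (z * only spent x) (suc y * only qf x))
    then λ c₁ → gather z (suc y)
      (≈-trans c₁ λ x → lemma₂ (z * only spent x) (suc y * only qf x) (only qf x))
    where
    lemma₁ : ∀ s a b → (s + a) + b ≡ (a + b) + s
    lemma₁ = solve-∀
    lemma₂ : ∀ a b f → (a + b) + f ≡ a + (f + b)
    lemma₂ = solve-∀

  -- Units cannot reach `qf` by themselves, so the leader decrements them away through the loops at
  -- h, from the highest register downwards; those from n on are already empty.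
  disband : ∀ n {C R z} → n ≤ K → (∀ x → n ≤ x → R x ≡ 0) → Leading C h 0 R z → CanFinish C
  disband zero {C} {R} {z} _ none (leading c) =
    step-nbr polarised (λ x → z * only spent x) (complete fin!) unheard
      (≈-trans c λ x → cong (λ u → (u + z * only spent x) + only (pc h) x) (ones-zero (λ x → none x z≤n) x))
    then λ c₁ → gather z 0 (≈-trans c₁ λ x → cong (z * only spent x +_) (sym (+-identityʳ _)))
    where
    unheard : ∀ {s₂ s₂′} → (s₂ , recv fin , s₂′) ∈ TT → z * only spent s₂ ≡ 0
    unheard i with sound i
    ... | fin? = *-zeroʳ z
  disband (suc n) {C} {R} n<K none = drain (R n) refl none
    where
    drain : ∀ v {C R z} → R n ≡ v → (∀ x → suc n ≤ x → R x ≡ 0) → Leading C h 0 R z → CanFinish C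
    drain zero {R = R} e none c = disband n (<⇒≤ n<K) below c
      where
      below : ∀ x → n ≤ x → R x ≡ 0
      below x le with m≤n⇒m<n∨m≡n le
      ... | inj₁ lt   = none x lt
      ... | inj₂ refl = e
    drain (suc v) {C} {R} {z} e none =
      after-dec {S = update R n v} (clear∈E n<K) split
        (drain v (update-same R n v) λ x le → trans (update-other R v (>⇒≢ le)) (none x le))
      where
      split : ∀ x → R x ≡ update R n v x + unit n x
      split x with x ≟ n
      ... | yes refl = trans e (trans (+-comm 1 v) (cong (v +_) (sym (unit-refl n))))
      ... | no ne = sym (trans (cong (R x +_) (unit-≢ (≢-sym ne))) (+-identityʳ (R x)))

  -- Spent processes are not reused, so every increment takes a fresh one from the pool. The number
  -- must be exact: a process left in the pool at the end would be stranded.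
  incs : ∀ {i R} → Halts E h i R → ℕ
  incs halt         = 0
  incs (inc _ _ p)  = suc (incs p)
  incs (dec _ _ p)  = incs p
  incs (zero _ _ p) = incs p
  incs (jump _ p)   = incs p

  finish : ∀ {i R} (p : Halts E h i R) {C z} → (∀ x → K ≤ x → R x ≡ 0) →
           Leading C i (incs p) R z → CanFinish C
  finish halt none = disband K ≤-refl none
  finish (inc m e p) none = after-inc m e
    (finish p λ x le → trans (e x) (cong₂ _+_ (none x le) (unit-≢ (<⇒≢ (≤-trans (inc<K m) le)))))
  finish (dec m e p) none = after-dec m e
    (finish p λ x le → m+n≡0⇒m≡0 _ (trans (sym (e x)) (none x le)))
  finish (zero {r = r} {R = R} m e p) {z = z} none (leading c) =
    step-nbr polarised (crowd (incs p) R z) (complete (zero! m)) unheard c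
    then λ c′ → finish p {z = z} none (leading c′)
    where
    unheard : ∀ {s₂ s₂′} → (s₂ , recv (zero r) , s₂′) ∈ TT → crowd (incs p) R z s₂ ≡ 0
    unheard i with sound i
    ... | zero? _ = cong₂ _+_ (*-zeroʳ (incs p)) (cong₂ _+_ e (*-zeroʳ z))
  finish (jump {R = R} m p) {z = z} none (leading c) =
    step-int polarised (crowd (incs p) R z) (complete (jump m)) c
    then λ c′ → finish p {z = z} none (leading c′)

  recruit : ∀ n l {C} → (∀ {C} → Leading C start (n + l) (λ _ → 0) 0 → CanFinish C) →
            C ≈ (λ x → suc n * only qin x + l * only pool x) → CanFinish C
  recruit zero l done c =
    step-int polarised (λ x → l * only pool x) (complete launch)
      (≈-trans c λ x → trans (cong (_+ l * only pool x) (+-identityʳ _)) (+-comm (only qin x) _))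
    then λ c′ → done (leading (≈-trans c′ λ x → cong (_+ only (pc start) x)
      (sym (trans (cong (λ u → l * only pool x + (u + 0)) (ones-zero (λ _ → refl) x)) (+-identityʳ _)))))
  recruit (suc n) l done c =
    step-int polarised (λ x → suc n * only qin x + l * only pool x) (complete supply)
      (≈-trans c λ x → lemma₁ (only qin x) (suc n * only qin x) (l * only pool x))
    then λ c′ → recruit n (suc l)
      (λ {C} c → done (subst (λ k → Leading C start k (λ _ → 0) 0) (+-suc n l) c))
      (≈-trans c′ λ x → lemma₂ (suc n * only qin x) (l * only pool x) (only pool x))
    where
    lemma₁ : ∀ s a b → (s + a) + b ≡ (a + b) + s
    lemma₁ = solve-∀
    lemma₂ : ∀ a b p → (a + b) + p ≡ a + (p + b)
    lemma₂ = solve-∀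

  halts⇒synchro : Halts E h start (λ _ → 0) → Synchro protocol
  halts⇒synchro p = C₀ , proj₁ res , (nonempty , elsewhere) , proj₁ (proj₂ res) , proj₂ (proj₂ res)
    where
    n = incs p
    C₀ : Cfg
    C₀ q = suc n * only qin (role q)
    qin-fits : Fits Q qin
    qin-fits = proj₁ (All.lookup bounded (complete launch))
    nonempty : size C₀ > 0
    nonempty = ≤-trans (s≤s z≤n) (≤-size C₀ (st qin))
    elsewhere : ∀ q → q ≢ st qin → C₀ q ≡ 0
    elsewhere q ne = trans (cong (suc n *_) (trans (only-role qin-fits q) (δ-≢ (≢-sym ne)))) (*-zeroʳ n)
    res : CanFinish C₀
    res = recruit n 0
      (λ {C} c → finish p (λ _ _ → refl) (subst (λ k → Leading C start k (λ _ → 0) 0) (+-identityʳ n) c))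
      (cells λ q → sym (+-identityʳ _))

-- The edges of a register machine

nth-just : ∀ {A : Set} (xs : List A) i {x} → nth xs i ≡ just x → i < length xs
nth-just (x ∷ xs) zero    e = s≤s z≤n
nth-just (x ∷ xs) (suc i) e = s≤s (nth-just xs i e)

nth-nothing : ∀ {A : Set} (xs : List A) i → nth xs i ≡ nothing → length xs ≤ i
nth-nothing []       i       e = z≤n
nth-nothing (x ∷ xs) (suc i) e = s≤s (nth-nothing xs i e)

nth-beyond : ∀ {A : Set} (xs : List A) i → length xs ≤ i → nth xs i ≡ nothing
nth-beyond []       i       _        = refl
nth-beyond (x ∷ xs) (suc i) (s≤s le) = nth-beyond xs i le

-- All addresses outside a program of length L are represented by L; the machine accepts
-- by reaching suc L, which it enters on halting with register 0 empty.
edges₁ : ℕ → ℕ → Instr → List Edge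
edges₁ L i (inc r j)    = (i , inc r , j ⊓ L) ∷ []
edges₁ L i (decj r j k) = (i , dec r , j ⊓ L) ∷ (i , zero r , k ⊓ L) ∷ []
edges₁ L i halt         = (i , zero 0 , suc L) ∷ []

edgesFrom : ℕ → ℕ → Program → List Edge
edgesFrom L i []      = (L , zero 0 , suc L) ∷ []
edgesFrom L i (x ∷ p) = edges₁ L i x ++ edgesFrom L (suc i) p

edgesFrom⁺ : ∀ L o p i {x e} → nth p i ≡ just x → e ∈ edges₁ L (o + i) x → e ∈ edgesFrom L o p
edgesFrom⁺ L o (y ∷ p) zero refl m rewrite +-identityʳ o = ∈-++⁺ˡ m
edgesFrom⁺ L o (y ∷ p) (suc i) {x} {e} eq m =
  ∈-++⁺ʳ (edges₁ L o y) (edgesFrom⁺ L (suc o) p i eq (subst (λ a → e ∈ edges₁ L a x) (+-suc o i) m))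

edgesFrom-end : ∀ L o p → (L , zero 0 , suc L) ∈ edgesFrom L o p
edgesFrom-end L o []      = here refl
edgesFrom-end L o (x ∷ p) = ∈-++⁺ʳ (edges₁ L o x) (edgesFrom-end L (suc o) p)

data InstrEdge (N : Program) : ℕ → Op → ℕ → Set where
  inc  : ∀ {i r j} → nth N i ≡ just (inc r j) → InstrEdge N i (inc r) (j ⊓ length N)
  dec  : ∀ {i r j k} → nth N i ≡ just (decj r j k) → InstrEdge N i (dec r) (j ⊓ length N)
  zero : ∀ {i r j k} → nth N i ≡ just (decj r j k) → InstrEdge N i (zero r) (k ⊓ length N)
  stop : ∀ {i} → nth N i ≡ just halt → InstrEdge N i (zero 0) (suc (length N))
  end  : InstrEdge N (length N) (zero 0) (suc (length N))

edgesFrom⁻ : ∀ L o p {e} → e ∈ edgesFrom L o p →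
             (∃ λ i → ∃ λ x → nth p i ≡ just x × e ∈ edges₁ L (o + i) x) ⊎ e ≡ (L , zero 0 , suc L)
edgesFrom⁻ L o [] (here refl) = inj₂ refl
edgesFrom⁻ L o (x ∷ p) {e} m with ∈-++⁻ (edges₁ L o x) m
... | inj₁ m′ = inj₁ (0 , x , refl , subst (λ a → e ∈ edges₁ L a x) (sym (+-identityʳ o)) m′)
... | inj₂ m′ with edgesFrom⁻ L (suc o) p m′
...   | inj₁ (i , y , eq , m″) = inj₁ (suc i , y , eq , subst (λ a → e ∈ edges₁ L a y) (sym (+-suc o i)) m″)
...   | inj₂ eq = inj₂ eq

instrEdge : ∀ N {i op j} → (i , op , j) ∈ edgesFrom (length N) 0 N → InstrEdge N i op j
instrEdge N m with edgesFrom⁻ (length N) 0 N m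
... | inj₂ refl = end
... | inj₁ (i , inc r j , eq , here refl) = inc eq
... | inj₁ (i , decj r j k , eq , here refl) = dec eq
... | inj₁ (i , decj r j k , eq , there (here refl)) = zero eq
... | inj₁ (i , halt , eq , here refl) = stop eq

used : Instr → ℕ
used (inc r j)    = suc r
used (decj r j k) = suc r
used halt         = 0

-- At least 1 because input and output use register 0.
width : Program → ℕ
width []      = 1
width (x ∷ p) = used x + width p

width-pos : ∀ p → 0 < width p
width-pos []      = s≤s z≤n
width-pos (x ∷ p) = ≤-trans (width-pos p) (m≤n+m _ (used x))

used≤width : ∀ p i {x} → nth p i ≡ just x → used x ≤ width p
used≤width (x ∷ p) zero    refl = m≤m+n _ _
used≤width (y ∷ p) (suc i) e    = ≤-trans (used≤width p i e) (m≤n+m _ (used y))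

-- A leader at address t + m adds m to register 0 and goes to address 0.

load : ℕ → ℕ → List Edge → List Edge
load t zero    es = es
load t (suc m) es = load t m ((t + suc m , inc 0 , t + m) ∷ es)

load⁻ : ∀ t n es {e} → e ∈ load t n es → (∃ λ m → m < n × e ≡ (t + suc m , inc 0 , t + m)) ⊎ e ∈ es
load⁻ t zero    es i = inj₂ i
load⁻ t (suc n) es i with load⁻ t n _ i
... | inj₁ (m , m<n , eq)   = inj₁ (m , m<n⇒m<1+n m<n , eq)
... | inj₂ (here refl)      = inj₁ (n , n<1+n n , refl)
... | inj₂ (there i′)       = inj₂ i′

load-old : ∀ t n {es e} → e ∈ es → e ∈ load t n es
load-old t zero    i = i
load-old t (suc n) i = load-old t n (there i)

load-new : ∀ t n es {m} → m < n → (t + suc m , inc 0 , t + m) ∈ load t n es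
load-new t (suc n) es {m} (s≤s le) with m≤n⇒m<n∨m≡n le
... | inj₁ lt   = load-new t n _ lt
... | inj₂ refl = load-old t n (here refl)

disbanding : Program → List Edge
disbanding N = map (λ r → suc (length N) , dec r , suc (length N)) (upTo (width N))

fixedEdges : Program → List Edge
fixedEdges N = edgesFrom (length N) 0 N ++ disbanding N

edges : Program → ℕ → List Edge
edges N t = (t , jump , 0) ∷ load t t (fixedEdges N)

data LoadedEdge (N : Program) (t : ℕ) : ℕ → Op → ℕ → Set where
  link    : LoadedEdge N t t jump 0
  chain   : ∀ {m} → m < t → LoadedEdge N t (t + suc m) (inc 0) (t + m)
  instr   : ∀ {i op j} → InstrEdge N i op j → LoadedEdge N t i op j
  disband : ∀ {r} → r < width N → LoadedEdge N t (suc (length N)) (dec r) (suc (length N))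

edges⁻ : ∀ N t {i op j} → (i , op , j) ∈ edges N t → LoadedEdge N t i op j
edges⁻ N t (here refl) = link
edges⁻ N t (there m) with load⁻ t t _ m
... | inj₁ (m , lt , refl) = chain lt
... | inj₂ m′ with ∈-++⁻ (edgesFrom (length N) 0 N) m′
...   | inj₁ m″ = instr (instrEdge N m″)
...   | inj₂ m″ with ∈-map⁻ _ m″
...     | r , r∈ , refl = disband (∈-upTo⁻ r∈)

edges-instr : ∀ N t {i x e} → nth N i ≡ just x → e ∈ edges₁ (length N) i x → e ∈ edges N t
edges-instr N t {i} eq m = there (load-old t t (∈-++⁺ˡ (edgesFrom⁺ (length N) 0 N i eq m)))

edges-end : ∀ N t → (length N , zero 0 , suc (length N)) ∈ edges N t
edges-end N t = there (load-old t t (∈-++⁺ˡ (edgesFrom-end (length N) 0 N)))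

edges-disband : ∀ N t {r} → r < width N → (suc (length N) , dec r , suc (length N)) ∈ edges N t
edges-disband N t lt = there (load-old t t (∈-++⁺ʳ (edgesFrom (length N) 0 N) (∈-map⁺ _ (∈-upTo⁺ lt))))

module _ (N : Program) (t : ℕ) (h<t : suc (length N) < t) where

  private
    L h : ℕ
    L = length N
    h = suc L
    E : List Edge
    E = edges N t

  edges-inc<width : ∀ {i r j} → (i , inc r , j) ∈ E → r < width N
  edges-inc<width m with edges⁻ N t m
  ... | chain _ = width-pos N
  ... | instr (inc {i} e) = used≤width N i e

  edges-dec<width : ∀ {i r j} → (i , dec r , j) ∈ E → r < width N
  edges-dec<width m with edges⁻ N t m
  ... | disband lt = lt
  ... | instr (dec {i} e) = used≤width N i e

  edges-zero<width : ∀ {i r j} → (i , zero r , j) ∈ E → r < width N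
  edges-zero<width m with edges⁻ N t m
  ... | instr (zero {i} e) = used≤width N i e
  ... | instr (stop _) = width-pos N
  ... | instr end = width-pos N

  instr-≤ : ∀ {i op j} → InstrEdge N i op j → i ≤ L
  instr-≤ (inc {i} e)  = <⇒≤ (nth-just N i e)
  instr-≤ (dec {i} e)  = <⇒≤ (nth-just N i e)
  instr-≤ (zero {i} e) = <⇒≤ (nth-just N i e)
  instr-≤ (stop {i} e) = <⇒≤ (nth-just N i e)
  instr-≤ end          = ≤-refl

  -- Loader addresses begin at t, beyond h and all addresses of the program, so the edge leaving
  -- `t + m` is determined by m.
  from-loader : ∀ {i op j} m → LoadedEdge N t i op j → i ≡ t + m →
                (m ≡ 0 × op ≡ jump × j ≡ 0) ⊎ (∃ λ m′ → m ≡ suc m′ × op ≡ inc 0 × j ≡ t + m′)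
  from-loader m link e = inj₁ (+-cancelˡ-≡ t m 0 (trans (sym e) (sym (+-identityʳ t))) , refl , refl)
  from-loader m (chain {m′} _) e = inj₂ (m′ , sym (+-cancelˡ-≡ t (suc m′) m e) , refl , refl)
  from-loader m (instr ie) e = contradiction
    (≤-trans (m≤m+n t m) (≤-trans (≤-reflexive (sym e)) (≤-trans (instr-≤ ie) (n≤1+n L)))) (<⇒≱ h<t)
  from-loader m (disband _) e = contradiction (≤-trans (m≤m+n t m) (≤-reflexive (sym e))) (<⇒≱ h<t)

  from-program : ∀ {i op j} → LoadedEdge N t i op j → i ≤ L → InstrEdge N i op j
  from-program link le = contradiction (≤-trans le (n≤1+n L)) (<⇒≱ h<t)
  from-program (chain {m} _) le = contradiction
    (≤-trans (m≤m+n t (suc m)) (≤-trans le (n≤1+n L))) (<⇒≱ h<t)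
  from-program (instr ie) le = ie
  from-program (disband _) le = contradiction le 1+n≰n

  unload : ∀ {i R} → Halts E h i R → ∀ m → i ≡ t + m →
           ∃ λ S → Halts E h 0 S × (∀ x → S x ≡ R x + m * unit 0 x)
  unload halt m e = contradiction (≤-trans (m≤m+n t m) (≤-reflexive (sym e))) (<⇒≱ h<t)
  unload (inc {R = R} i∈ eq p) m e with from-loader m (edges⁻ N t i∈) e
  ... | inj₂ (m′ , refl , refl , refl) with unload p m′ refl
  ...   | S , q , eq′ = S , q , λ x → trans (eq′ x) (trans (cong (_+ m′ * unit 0 x) (eq x)) (+-assoc (R x) (unit 0 x) (m′ * unit 0 x)))
  unload (dec i∈ eq p) m e with from-loader m (edges⁻ N t i∈) e
  ... | inj₁ (_ , () , _)
  ... | inj₂ (_ , _ , () , _)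
  unload (zero i∈ z p) m e with from-loader m (edges⁻ N t i∈) e
  ... | inj₁ (_ , () , _)
  ... | inj₂ (_ , _ , () , _)
  unload (jump {R = R} i∈ p) m e with from-loader m (edges⁻ N t i∈) e
  ... | inj₁ (refl , _ , refl) = R , p , λ x → sym (+-identityʳ _)

  reload : ∀ m {R S : Regs} → m ≤ t → (∀ x → S x ≡ R x + m * unit 0 x) → Halts E h 0 S → Halts E h (t + m) R
  reload zero le eq p = subst (λ a → Halts E h a _) (sym (+-identityʳ t))
    (jump (here refl) (halts-cong (λ x → trans (eq x) (+-identityʳ _)) p))
  reload (suc m) {R} le eq p = inc {S = λ x → R x + unit 0 x} (there (load-new t t _ le)) (λ x → refl)
    (reload m (<⇒≤ le) (λ x → trans (eq x) (sym (+-assoc (R x) (unit 0 x) (m * unit 0 x)))) p)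

  ⊓-inside : ∀ {a i} → a ⊓ L ≡ i → i < L → a ≡ i
  ⊓-inside {a} e lt with ≤-total a L
  ... | inj₁ le = trans (sym (m≤n⇒m⊓n≡m le)) e
  ... | inj₂ ge = contradiction (trans (sym e) (m≥n⇒m⊓n≡n ge)) (<⇒≢ lt)

  run-nothing : ∀ {a} {R : Regs} → nth N a ≡ nothing → R 0 ≡ 0 → run N a R 1 ≡ just 0
  run-nothing eq z rewrite eq = cong just z

  run-halt : ∀ {a} {R : Regs} → nth N a ≡ just halt → R 0 ≡ 0 → run N a R 1 ≡ just 0
  run-halt eq z rewrite eq = cong just z

  -- Stated for every address a represented by i, since the machine may leave its program to any
  -- address while the edges only know L.
  halts⇒run : ∀ {i R} → Halts E h i R → ∀ a → a ⊓ L ≡ i → ∃ λ f → run N a R f ≡ just 0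
  halts⇒run halt a e = contradiction (≤-trans (≤-reflexive (sym e)) (m⊓n≤n a L)) 1+n≰n
  halts⇒run (inc i∈ eq p) a e with from-program (edges⁻ N t i∈) (≤-trans (≤-reflexive (sym e)) (m⊓n≤n a L))
  ... | inc {i} {r} {j} at with ⊓-inside e (nth-just N i at) | halts⇒run p j refl
  ...   | refl | f , ran = suc f , trans (run-inc N f at) (trans (run-cong N j f (λ x → sym (trans (eq x) (incremented _ r x)))) ran)
    where
    incremented : ∀ (R : Regs) r x → R x + unit r x ≡ update R r (suc (R r)) x
    incremented R r x with x ≟ r
    ... | yes refl = trans (cong (R r +_) (unit-refl r)) (+-comm (R r) 1)
    ... | no ne = trans (cong (R x +_) (unit-≢ (≢-sym ne))) (+-identityʳ (R x))
  halts⇒run (dec {R = R} {S = S} i∈ eq p) a e with from-program (edges⁻ N t i∈) (≤-trans (≤-reflexive (sym e)) (m⊓n≤n a L))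
  ... | dec {i} {r} {j} at with ⊓-inside e (nth-just N i at) | halts⇒run p j refl
  ...   | refl | f , ran = suc f , trans (run-dec N f at (trans (eq r) (trans (cong (S r +_) (unit-refl r)) (+-comm (S r) 1))))
    (trans (run-cong N j f decremented) ran)
    where
    decremented : ∀ x → update R r (S r) x ≡ S x
    decremented x with x ≟ r
    ... | yes refl = refl
    ... | no ne = trans (eq x) (trans (cong (S x +_) (unit-≢ (≢-sym ne))) (+-identityʳ (S x)))
  halts⇒run (zero i∈ z p) a e with from-program (edges⁻ N t i∈) (≤-trans (≤-reflexive (sym e)) (m⊓n≤n a L))
  ... | zero {i} {r} {j} {k} at with ⊓-inside e (nth-just N i at) | halts⇒run p k refl
  ...   | refl | f , ran = suc f , trans (run-zero N f at z) ran
  -- Taking this edge, with register 0 empty, is how the counter machine accepts; `N` itself stops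
  -- here with output 0.
  halts⇒run (zero i∈ z p) a e | stop {i} at with ⊓-inside e (nth-just N i at)
  ...   | refl = 1 , run-halt at z
  halts⇒run (zero i∈ z p) a e | end = 1 , run-nothing (nth-beyond N a (m⊓n≡n⇒n≤m e)) z
  halts⇒run (jump i∈ p) a e with from-program (edges⁻ N t i∈) (≤-trans (≤-reflexive (sym e)) (m⊓n≤n a L))
  ... | ()

  run⇒halts : ∀ a R f → run N a R f ≡ just 0 → Halts E h (a ⊓ L) R
  run⇒halts a R (suc f) ran with nth N a in eq
  ... | nothing rewrite m≥n⇒m⊓n≡n (nth-nothing N a eq) = zero (edges-end N t) (just-injective ran) halt
  ... | just x rewrite m≤n⇒m⊓n≡m (<⇒≤ (nth-just N a eq)) with x
  ...   | halt = zero (edges-instr N t eq (here refl)) (just-injective ran) halt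
  ...   | inc r j = inc (edges-instr N t eq (here refl)) incremented (run⇒halts j _ f ran)
    where
    incremented : ∀ x → update R r (suc (R r)) x ≡ R x + unit r x
    incremented x with x ≟ r
    ... | yes refl = sym (trans (cong (R r +_) (unit-refl r)) (+-comm (R r) 1))
    ... | no ne = sym (trans (cong (R x +_) (unit-≢ (≢-sym ne))) (+-identityʳ (R x)))
  ...   | decj r j k with R r in eqr
  ...     | zero = zero (edges-instr N t eq (there (here refl))) eqr (run⇒halts k R f ran)
  ...     | suc v = dec (edges-instr N t eq (here refl)) decremented (run⇒halts j _ f ran)
    where
    decremented : ∀ x → R x ≡ update R r v x + unit r x
    decremented x with x ≟ r
    ... | yes refl = trans eqr (trans (+-comm 1 v) (cong (v +_) (sym (unit-refl r))))
    ... | no ne = sym (trans (cong (R x +_) (unit-≢ (≢-sym ne))) (+-identityʳ (R x)))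

  initRegs-unit : ∀ x → initRegs t x ≡ 0 + t * unit 0 x
  initRegs-unit zero    = sym (*-identityʳ t)
  initRegs-unit (suc x) = sym (*-zeroʳ t)

  halts⇒run₀ : Halts E h (t + t) (λ _ → 0) → ∃ λ f → run N 0 (initRegs t) f ≡ just 0
  halts⇒run₀ p with unload p t refl
  ... | S , q , eq with halts⇒run q 0 refl
  ...   | f , ran = f , trans (run-cong N 0 f (λ x → trans (initRegs-unit x) (sym (eq x)))) ran

  run₀⇒halts : ∀ f → run N 0 (initRegs t) f ≡ just 0 → Halts E h (t + t) (λ _ → 0)
  run₀⇒halts f ran = reload t ≤-refl initRegs-unit (run⇒halts 0 (initRegs t) f ran)

-- The list of transitions

trs : Edge → List Trans
trs (i , inc r , j)  = (pc i , send (inc r) , w j) ∷ (w j , recv ack , pc j) ∷ []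
trs (i , dec r , j)  = (pc i , send (dec r) , w j) ∷ (w j , recv ack , pc j) ∷ []
trs (i , zero r , j) = (pc i , send (zero r) , pc j) ∷ []
trs (i , jump , j)   = (pc i , τ , pc j) ∷ []

unitTrs : ℕ → List Trans
unitTrs r = (pool , recv (inc r) , up r) ∷ (up r , send ack , one r) ∷
            (one r , recv (dec r) , down) ∷ (one r , recv (zero r) , dead) ∷ []

crewTrs : ℕ → ℕ → List Trans
crewTrs h K = (qin , τ , pool) ∷ (down , send ack , spent) ∷ (spent , τ , qf) ∷
              (pc h , send fin , qf) ∷ (qf , recv fin , dead) ∷ concatMap unitTrs (upTo K)

edgeTrs : List Edge → ℕ → ℕ → List Trans
edgeTrs E h K = concatMap trs E ++ crewTrs h K

allTrs : List Edge → ℕ → ℕ → ℕ → List Trans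
allTrs E start h K = (qin , τ , pc start) ∷ edgeTrs E h K

∈trs⇒Tr : ∀ {E start h K s a s′} e → e ∈ E → (s , a , s′) ∈ trs e → Tr E start h K s a s′
∈trs⇒Tr (i , inc r , j)  m (here refl)         = inc! m
∈trs⇒Tr (i , inc r , j)  m (there (here refl)) = inc✓ m
∈trs⇒Tr (i , dec r , j)  m (here refl)         = dec! m
∈trs⇒Tr (i , dec r , j)  m (there (here refl)) = dec✓ m
∈trs⇒Tr (i , zero r , j) m (here refl)         = zero! m
∈trs⇒Tr (i , jump , j)   m (here refl)         = jump m

∈unitTrs⇒Tr : ∀ {E start h K s a s′} r → r < K → (s , a , s′) ∈ unitTrs r → Tr E start h K s a s′
∈unitTrs⇒Tr r lt (here refl)                         = inc? lt
∈unitTrs⇒Tr r lt (there (here refl))                 = up! lt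
∈unitTrs⇒Tr r lt (there (there (here refl)))         = dec? lt
∈unitTrs⇒Tr r lt (there (there (there (here refl)))) = zero? lt

allTrs-sound : ∀ E start h K {s a s′} → (s , a , s′) ∈ allTrs E start h K → Tr E start h K s a s′
allTrs-sound E start h K (here refl) = launch
allTrs-sound E start h K (there i) with ∈-++⁻ (concatMap trs E) i
... | inj₁ j with find (∈-concatMap⁻ trs {xs = E} j)
...   | e , e∈ , k = ∈trs⇒Tr e e∈ k
allTrs-sound E start h K (there i) | inj₂ (here refl) = supply
allTrs-sound E start h K (there i) | inj₂ (there (here refl)) = down!
allTrs-sound E start h K (there i) | inj₂ (there (there (here refl))) = retire
allTrs-sound E start h K (there i) | inj₂ (there (there (there (here refl)))) = fin!
allTrs-sound E start h K (there i) | inj₂ (there (there (there (there (here refl))))) = fin?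
allTrs-sound E start h K (there i) | inj₂ (there (there (there (there (there j)))))
  with find (∈-concatMap⁻ unitTrs {xs = upTo K} j)
... | r , r∈ , k = ∈unitTrs⇒Tr r (∈-upTo⁻ r∈) k

allTrs-complete : ∀ E start h K {s a s′} → Tr E start h K s a s′ → (s , a , s′) ∈ allTrs E start h K
allTrs-complete E start h K = λ where
    launch    → here refl
    supply    → crew (here refl)
    down!     → crew (there (here refl))
    retire    → crew (there (there (here refl)))
    fin!      → crew (there (there (there (here refl))))
    fin?      → crew (there (there (there (there (here refl)))))
    (inc? lt)  → unit-of lt (here refl)
    (up! lt)   → unit-of lt (there (here refl))
    (dec? lt)  → unit-of lt (there (there (here refl)))
    (zero? lt) → unit-of lt (there (there (there (here refl))))
    (jump m)  → edge m (here refl)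
    (inc! m)  → edge m (here refl)
    (inc✓ m)  → edge m (there (here refl))
    (dec! m)  → edge m (here refl)
    (dec✓ m)  → edge m (there (here refl))
    (zero! m) → edge m (here refl)
  where
  crew : ∀ {x} → x ∈ crewTrs h K → x ∈ allTrs E start h K
  crew i = there (∈-++⁺ʳ (concatMap trs E) i)
  edge : ∀ {x e} → e ∈ E → x ∈ trs e → x ∈ allTrs E start h K
  edge m i = there (∈-++⁺ˡ (∈-concatMap⁺ trs (lose m i)))
  unit-of : ∀ {x r} → r < K → x ∈ unitTrs r → x ∈ allTrs E start h K
  unit-of lt i = crew (there (there (there (there (there (∈-concatMap⁺ unitTrs (lose (∈-upTo⁺ lt) i)))))))

-- Cantor pairing

tri : ℕ → ℕ
tri zero    = 0
tri (suc n) = suc n + tri n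

tri*2 : ∀ n → n * suc n ≡ tri n * 2
tri*2 zero    = refl
tri*2 (suc n) = trans (lemma₁ n) (trans (cong (2 * suc n +_) (tri*2 n)) (lemma₂ (suc n) (tri n)))
  where
  lemma₁ : ∀ n → suc n * suc (suc n) ≡ 2 * suc n + n * suc n
  lemma₁ = solve-∀
  lemma₂ : ∀ a b → 2 * a + b * 2 ≡ (a + b) * 2
  lemma₂ = solve-∀

n≤tri : ∀ n → n ≤ tri n
n≤tri zero    = z≤n
n≤tri (suc n) = m≤m+n _ _

-- Opaque, since conversion checking would otherwise unfold the division in pair.
opaque
  cantor : ℕ → ℕ → ℕ
  cantor a b = tri (a + b) + b

  cantor≡tri : ∀ a b → cantor a b ≡ tri (a + b) + b
  cantor≡tri a b = refl

  pair≡cantor : ∀ a b → pair a b ≡ cantor a b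
  pair≡cantor a b = cong (_+ b) (trans (cong (_/ 2) (tri*2 (a + b))) (m*n/n≡m (tri (a + b)) 2))

  cantor-≥ˡ : ∀ a b → a ≤ cantor a b
  cantor-≥ˡ a b = ≤-trans (m≤m+n a b) (≤-trans (n≤tri (a + b)) (m≤m+n _ b))

  cantor-≥ʳ : ∀ a b → b ≤ cantor a b
  cantor-≥ʳ a b = m≤n+m b _

encode : List ℕ → ℕ
encode []       = 0
encode (x ∷ xs) = suc (cantor x (encode xs))

encList≡encode : ∀ xs → encList xs ≡ encode xs
encList≡encode []       = refl
encList≡encode (x ∷ xs) = cong suc (trans (cong (pair x) (encList≡encode xs)) (pair≡cantor x _))

module _ (P : Protocol) where
  private module P = Protocol P

  code≡encode : code P ≡ encode (P.nQ ∷ P.nΣ ∷ toℕ P.qin ∷ toℕ P.qf ∷ encode (mapL encTrans P.T) ∷ [])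
  code≡encode = trans (encList≡encode (P.nQ ∷ P.nΣ ∷ toℕ P.qin ∷ toℕ P.qf ∷ encList (mapL encTrans P.T) ∷ []))
    (cong (λ c → encode (P.nQ ∷ P.nΣ ∷ toℕ P.qin ∷ toℕ P.qf ∷ c ∷ [])) (encList≡encode (mapL encTrans P.T)))

-- The pairing is at least each of its arguments. This is how t comes to bound everything mentioned
-- in the transitions it codes.
encode-∈ : ∀ {x xs} → x ∈ xs → x < encode xs
encode-∈ {x} {_ ∷ xs} (here refl) = s≤s (cantor-≥ˡ x (encode xs))
encode-∈ {x} {y ∷ xs} (there i)   = m≤n⇒m≤1+n (≤-trans (encode-∈ i) (cantor-≥ʳ y (encode xs)))

encT : Trans → ℕ
encT (s , a , s′) = cantor (enc s) (cantor (encA a) (enc s′))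

-- Computable functions

record Computable {Γ} (f : Vec ℕ Γ → ℕ) : Set where
  constructor computed
  field
    exp     : Exp Γ
    correct : ∀ ρ → ⟦ exp ⟧ ρ ≡ f ρ
open Computable

downto0-cong : ∀ {f g} → (∀ m a → f m a ≡ g m a) → ∀ n a → downto0 f n a ≡ downto0 g n a
downto0-cong e zero    a = refl
downto0-cong {f} e (suc n) a = trans (cong (downto0 f n) (e n a)) (downto0-cong e n _)

respects : ∀ {Γ} {f g : Vec ℕ Γ → ℕ} → (∀ ρ → f ρ ≡ g ρ) → Computable f → Computable g
respects e (computed x c) = computed x λ ρ → trans (c ρ) (e ρ)

arg! : ∀ {Γ} i → Computable {Γ} (λ ρ → lookup ρ i)
arg! i = computed (var i) λ ρ → refl

suc! : ∀ {Γ} {f : Vec ℕ Γ → ℕ} → Computable f → Computable (λ ρ → suc (f ρ))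
suc! (computed x c) = computed (su x) λ ρ → cong suc (c ρ)

const! : ∀ {Γ} n → Computable {Γ} (λ _ → n)
const! zero    = computed ze λ ρ → refl
const! (suc n) = suc! (const! n)

loop! : ∀ {Γ} {n b : Vec ℕ Γ → ℕ} {s : Vec ℕ (suc (suc Γ)) → ℕ} → Computable n → Computable b → Computable s →
        Computable (λ ρ → downto0 (λ m a → s (a ∷ m ∷ ρ)) (n ρ) (b ρ))
loop! {n = n} {b} {s} (computed xn cn) (computed xb cb) (computed xs cs) = computed (loop xn xb xs) λ ρ →
  trans (cong₂ (downto0 _) (cn ρ) (cb ρ)) (downto0-cong (λ m a → cs (a ∷ m ∷ ρ)) (n ρ) (b ρ))

add! : ∀ {Γ} {f g : Vec ℕ Γ → ℕ} → Computable f → Computable g → Computable (λ ρ → f ρ + g ρ)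
add! {f = f} {g} cf cg = respects (λ ρ → lemma (f ρ) (g ρ)) (loop! cf cg (suc! (arg! zero)))
  where
  lemma : ∀ m n → downto0 (λ _ a → suc a) m n ≡ m + n
  lemma zero    n = refl
  lemma (suc m) n = trans (lemma m (suc n)) (+-suc m n)

quadruple! : ∀ {Γ} {f : Vec ℕ Γ → ℕ} → Computable f → Computable (λ ρ → f ρ * 4)
quadruple! {f = f} cf = respects (λ ρ → trans (lemma (f ρ) 0) (+-identityʳ _))
  (loop! cf (const! 0) (suc! (suc! (suc! (suc! (arg! zero))))))
  where
  lemma : ∀ m n → downto0 (λ _ a → suc (suc (suc (suc a)))) m n ≡ m * 4 + n
  lemma zero    n = refl
  lemma (suc m) n = trans (lemma m (4 + n)) (lemma₂ (m * 4) n)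
    where
    lemma₂ : ∀ k n → k + suc (suc (suc (suc n))) ≡ suc (suc (suc (suc (k + n))))
    lemma₂ = solve-∀

tri! : ∀ {Γ} {f : Vec ℕ Γ → ℕ} → Computable f → Computable (λ ρ → tri (f ρ))
tri! {f = f} cf = respects (λ ρ → trans (lemma (f ρ) 0) (+-identityʳ _))
  (loop! cf (const! 0) (suc! (add! (arg! (suc zero)) (arg! zero))))
  where
  lemma : ∀ m n → downto0 (λ m a → suc (m + a)) m n ≡ tri m + n
  lemma zero    n = refl
  lemma (suc m) n = trans (lemma m (suc (m + n))) (lemma₂ m (tri m) n)
    where
    lemma₂ : ∀ m t n → t + suc (m + n) ≡ (suc m + t) + n
    lemma₂ = solve-∀

pair! : ∀ {Γ} {f g : Vec ℕ Γ → ℕ} → Computable f → Computable g → Computable (λ ρ → cantor (f ρ) (g ρ))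
pair! {f = f} {g} cf cg = respects (λ ρ → sym (cantor≡tri (f ρ) (g ρ))) (add! (tri! (add! cf cg)) cg)

-- The code of the protocol depends on N only through c, the code of the transitions not involving t.

fixedTrs : Program → List Trans
fixedTrs N = edgeTrs (fixedEdges N) (suc (length N)) (width N)

loadStep : ℕ → ℕ → ℕ → ℕ
loadStep t m a =
  suc (cantor (encT (pc (t + suc m) , send (inc 0) , w (t + m)))
    (suc (cantor (encT (w (t + m) , recv ack , pc (t + m))) a)))

-- The leading numbers are the sizes `suc Q` and `suc S` of the final protocol and the codes of
-- `qin` and `qf`.
codeOf : (t c : ℕ) → ℕ
codeOf t c = encode (10 + (t + t) * 4 ∷ 3 + t ∷ 0 ∷ 1 ∷
  suc (cantor (encT (qin , τ , pc (t + t))) (suc (cantor (encT (pc t , τ , pc 0)) (downto0 (loadStep t) t c)))) ∷ [])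

-- Immediate by computation: `load` puts edges in front in the order in which `downto0` applies its
-- steps, and each edge gives the two transitions of `loadStep`.
encode-load : ∀ t m es {h K} → encode (map encT (edgeTrs (load t m es) h K)) ≡
              downto0 (loadStep t) m (encode (map encT (edgeTrs es h K)))
encode-load t zero    es = refl
encode-load t (suc m) es {h} {K} = encode-load t m _ {h} {K}

list! : ∀ {Γ} {f g : Vec ℕ Γ → ℕ} → Computable f → Computable g → Computable (λ ρ → suc (cantor (f ρ) (g ρ)))
list! cf cg = suc! (pair! cf cg)

pc! w! : ∀ {Γ} {f : Vec ℕ Γ → ℕ} → Computable f → Computable (λ ρ → _ + f ρ * 4)
pc! cf = add! (const! 8) (quadruple! cf)
w! cf = add! (const! 9) (quadruple! cf)

code-computable : Computable {1} (λ ρ → codeOf (lookup ρ zero) (lookup ρ zero))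
code-computable = list! (add! (const! 10) (quadruple! (add! t t))) (list! (add! (const! 3) t)
  (list! (const! 0) (list! (const! 1) (list!
    -- Constants below: 0 codes `qin` and the action `τ`, 8 codes `pc 0`, 5 codes `send (inc 0)` and
    -- 2 codes `recv ack`. In the loop, t is both the number of rounds and, as the code of the fixed
    -- tail, the starting value.
    (list! (pair! (const! 0) (pair! (const! 0) (pc! (add! t t))))
    (list! (pair! (pc! t) (pair! (const! 0) (const! 8)))
    (loop! t t
      (list! (pair! (pc! (add! t′ (suc! m))) (pair! (const! 5) (w! (add! t′ m))))
      (list! (pair! (w! (add! t′ m)) (pair! (const! 2) (pc! (add! t′ m)))) (arg! zero))))))
    (const! 0)))))
  where
  t : Computable {1} (λ ρ → lookup ρ zero)
  t = arg! zero
  t′ : Computable {3} (λ ρ → lookup ρ (suc (suc zero)))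
  t′ = arg! (suc (suc zero))
  m : Computable {3} (λ ρ → lookup ρ (suc zero))
  m = arg! (suc zero)

m≤m*4 : ∀ m → m ≤ m * 4
m≤m*4 m = m≤m*n m 4

boundedA : ∀ {n} a → encA a ≤ n → BoundedA n a
boundedA τ        le = tt
boundedA (send m) le = ≤-trans (≤-trans (m≤m+n _ _) (n≤1+n _)) le
boundedA (recv m) le = ≤-trans (≤-trans (m≤m+n _ _) (m≤n+m _ 2)) le

-- The protocol that refers to its own code

module Diagonal (N : Program) where

  t L h K Q S : ℕ
  t = encode (map encT (fixedTrs N))
  L = length N
  h = suc L
  K = width N
  -- The code of `w (t + t)`, which bounds all loader states. `S` makes room for `inc 0`, of code 2,
  -- besides the codes up to t.
  Q = 9 + (t + t) * 4
  S = 2 + t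

  E : List Edge
  E = edges N t

  TT : List Trans
  TT = allTrs E (t + t) h K

  -- The transition sending `fin` is among those coded by t and mentions `pc h`, whose code is at
  -- least h.
  h<t : h < t
  h<t = ≤-trans (s≤s (≤-trans (m≤m*4 h) (≤-trans (m≤n+m (h * 4) 8) (cantor-≥ˡ _ _))))
    (encode-∈ (∈-map⁺ encT
      (∈-++⁺ʳ (concatMap trs (fixedEdges N)) (there (there (there (here {x = pc h , send fin , qf} refl)))))))

  t≤Q : t ≤ Q
  t≤Q = ≤-trans (m≤m+n t t) (≤-trans (m≤m*4 (t + t)) (m≤n+m _ 9))

  bounded-fixed : ∀ {x} → x ∈ fixedTrs N → Bounded Q S x
  bounded-fixed {s , a , s′} i =
    fits (≤-trans (≤-trans (cantor-≥ˡ _ _) x≤t) t≤Q) ,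
    boundedA a (≤-trans (≤-trans (≤-trans (cantor-≥ˡ (encA a) (enc s′)) (cantor-≥ʳ (enc s) _)) x≤t) (m≤n+m t 2)) ,
    fits (≤-trans (≤-trans (≤-trans (cantor-≥ʳ (encA a) (enc s′)) (cantor-≥ʳ (enc s) _)) x≤t) t≤Q)
    where
    x≤t : encT (s , a , s′) ≤ t
    x≤t = <⇒≤ (encode-∈ (∈-map⁺ encT i))

  pc-fits : ∀ {i} → i ≤ t + t → Fits Q (pc i)
  pc-fits le = fits (≤-trans (+-monoʳ-≤ 8 (*-monoˡ-≤ 4 le)) (n≤1+n _))

  w-fits : ∀ {i} → i ≤ t + t → Fits Q (w i)
  w-fits le = fits (+-monoʳ-≤ 9 (*-monoˡ-≤ 4 le))

  bounded-load : ∀ m {x} → m < t → x ∈ trs (t + suc m , inc 0 , t + m) → Bounded Q S x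
  bounded-load m lt (here refl) =
    pc-fits (+-monoʳ-≤ t lt) , s≤s (s≤s z≤n) , w-fits (+-monoʳ-≤ t (<⇒≤ lt))
  bounded-load m lt (there (here refl)) =
    w-fits (+-monoʳ-≤ t (<⇒≤ lt)) , z≤n , pc-fits (+-monoʳ-≤ t (<⇒≤ lt))

  bounded : All (Bounded Q S) TT
  bounded = All.tabulate go
    where
    go : ∀ {x} → x ∈ TT → Bounded Q S x
    go (here refl) = fits z≤n , tt , pc-fits ≤-refl
    go (there i) with ∈-++⁻ (concatMap trs E) i
    ... | inj₂ j = bounded-fixed (∈-++⁺ʳ (concatMap trs (fixedEdges N)) j)
    ... | inj₁ j with find (∈-concatMap⁻ trs {xs = E} j)
    ...   | _ , here refl , here refl = pc-fits (m≤m+n t t) , tt , pc-fits z≤n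
    ...   | e , there e∈ , k with load⁻ t t _ e∈
    ...     | inj₁ (m , lt , refl) = bounded-load m lt k
    ...     | inj₂ e∈′ = bounded-fixed (∈-++⁺ˡ (∈-concatMap⁺ trs (lose e∈′ k)))

  protocol : Protocol
  protocol = Conv.protocol Q S TT bounded

  isWaitOnly : WaitOnly protocol
  isWaitOnly = Simulation.isWaitOnly Q S TT bounded E (t + t) h K
    (allTrs-sound E (t + t) h K) (allTrs-complete E (t + t) h K)
    (edges-inc<width N t h<t) (edges-dec<width N t h<t) (edges-zero<width N t h<t) (edges-disband N t)

  synchro⇒run : Synchro protocol → Computes N t 0
  synchro⇒run s = halts⇒run₀ N t h<t (Simulation.synchro⇒halts Q S TT bounded E (t + t) h K
    (allTrs-sound E (t + t) h K) (allTrs-complete E (t + t) h K)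
    (edges-inc<width N t h<t) (edges-dec<width N t h<t) (edges-zero<width N t h<t) (edges-disband N t) s)

  run⇒synchro : Computes N t 0 → Synchro protocol
  run⇒synchro (f , r) = Simulation.halts⇒synchro Q S TT bounded E (t + t) h K
    (allTrs-sound E (t + t) h K) (allTrs-complete E (t + t) h K)
    (edges-inc<width N t h<t) (edges-dec<width N t h<t) (edges-zero<width N t h<t) (edges-disband N t)
    (run₀⇒halts N t h<t f r)

  encAction-conv : ∀ a → BoundedA S a → encAction (convA S a) ≡ encA a
  encAction-conv τ        _  = refl
  encAction-conv (send m) le = cong (λ n → suc (2 * n)) (toℕ-cap le)
  encAction-conv (recv m) le = cong (λ n → 2 + 2 * n) (toℕ-cap le)

  encTrans-conv : ∀ {xs} → All (Bounded Q S) xs → mapL encTrans (map (Conv.conv Q S TT bounded) xs) ≡ map encT xs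
  encTrans-conv [] = refl
  encTrans-conv {(s , a , s′) ∷ xs} ((b , ba , b′) ∷ bs) = cong₂ _∷_
    (trans (cong₂ pair (toℕ-cap (Fits.enc≤ b)) (trans
        (cong₂ pair (encAction-conv a ba) (toℕ-cap (Fits.enc≤ b′))) (pair≡cantor (encA a) (enc s′))))
      (pair≡cantor (enc s) _))
    (encTrans-conv bs)

  encode-T : encode (mapL encTrans (Protocol.T protocol)) ≡
             suc (cantor (encT (qin , τ , pc (t + t))) (suc (cantor (encT (pc t , τ , pc 0)) (downto0 (loadStep t) t t))))
  encode-T = trans (cong encode (encTrans-conv bounded))
    (cong (λ c → suc (cantor (encT (qin , τ , pc (t + t))) (suc (cantor (encT (pc t , τ , pc 0)) c))))
      (encode-load t t (fixedEdges N) {h} {K}))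

  -- `N` enters only through t, so a program that maps n to `codeOf n n` can be fixed before the
  -- protocol built from it.
  code-protocol : code protocol ≡ codeOf t t
  code-protocol = trans (code≡encode protocol)
    (cong (λ c → encode (suc Q ∷ suc S ∷ 0 ∷ 1 ∷ c ∷ [])) encode-T)

-- The contradiction

computes-unique : ∀ {M n x y} → Computes M n x → Computes M n y → x ≡ y
computes-unique {M} {n} (f , rx) (g , ry) = just-injective (trans (sym (run-mono M 0 (initRegs n) f g rx))
  (trans (cong (run M 0 (initRegs n)) (+-comm f g)) (run-mono M 0 (initRegs n) g f ry)))

Follows : Program → ℕ → Program → ℕ → Set
Follows N n M c = ∃ λ k → ∀ f → run N 0 (initRegs n) (k + f) ≡ run M 0 (initRegs c) f

computes-back : ∀ {N n M c x} → Follows N n M c → Computes N n x → Computes M c x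
computes-back {N} {n} (k , follow) (f , r) =
  f , trans (sym (follow f)) (trans (cong (run N 0 (initRegs n)) (+-comm k f)) (run-mono N 0 (initRegs n) f k r))

computes-forth : ∀ {N n M c x} → Follows N n M c → Computes M c x → Computes N n x
computes-forth (k , follow) (f , r) = k + f , trans (follow f) r

-- If A held, `M` would answer 1 and, through `N`, also 0. So A fails, `M` answers 0, hence so does
-- `N`, and A holds after all. No case distinction on A is made.
diagonal : ∀ {A : Set} {N n M c} → Follows N n M c → (A → Computes N n 0) → (Computes N n 0 → A) →
           (A → Computes M c 1) × (¬ A → Computes M c 0) → ⊥
diagonal {A} {M = M} {c} fol to from (yes! , no!) = ¬A (from (computes-forth fol (no! ¬A)))
  where
  ¬A : ¬ A
  ¬A a = case (computes-unique {M} {c} (computes-back fol (to a)) (yes! a))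
    where
    case : 0 ≢ 1
    case ()

after-follows : ∀ M {f : ℕ → ℕ} (c : Computable {1} (λ ρ → f (lookup ρ zero))) n → Follows (M after exp c) n M (f n)
after-follows M {f} c n with leads-after M (exp c) n
... | k , follow = k , λ g → trans (follow g) (cong (λ m → run M 0 (initRegs m) g) (correct c (n ∷ [])))

module _ (Class : Protocol → Set) (member : ∀ N → Class (Diagonal.protocol N)) where

  not-decider : ∀ M N → (∀ n → Follows N n M (codeOf n n)) → ¬ DecidesOn Class Synchro M
  not-decider M N fol decides = diagonal (fol t) synchro⇒run run⇒synchro
    (subst (λ c → (Synchro protocol → Computes M c 1) × (¬ Synchro protocol → Computes M c 0))
      code-protocol (decides protocol (member N)))
    where open Diagonal N

  undecidable : ¬ Decidable-on Class Synchro
  undecidable (M , decides) =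
    not-decider M (M after exp code-computable) (after-follows M {λ n → codeOf n n} code-computable) decides

theorem7 : ¬ Decidable-on AllProtocols Synchro × ¬ Decidable-on WaitOnly Synchro
theorem7 = undecidable AllProtocols (λ _ → tt) , undecidable WaitOnly Diagonal.isWaitOnly
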